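{- Let $h$ be a positive integer such that $h \bmod 8 \in \{0,1,4,5\}$. The triangular grid $T_h$ is balanceable if and only if $h \bmod 8\in\{0,1\}$.
   Context: All graphs are simple and finite. $T_h$ is the (equilateral) triangular grid with $h$ vertices on each side: its vertices are $u_i^j$ with $1\le i\le j\le h$ ($u_i^j$ being the $i$th vertex from the left in the $j$th row from the top), and its edges are $u_i^ju_{i+1}^j$ (for $1\le i<j\le h$), $u_i^ju_i^{j+1}$ and $u_i^ju_{i+1}^{j+1}$ (for $1\le i\le j<h$). It has $\frac{3(h-1)h}{2}$ edges, which is even exactly when $h\bmod 8\in\{0,1,4,5\}$. A 2-coloring of the edges of $K_n$ is a function $\alpha:E(K_n)\to\{R,B\}$. It contains a balanced copy of a graph $G$ if $K_n$ has a (not necessarily induced) subgraph isomorphic to $G$ whose edge set is partitioned into $E_1,E_2$ with $\alpha(e)=R$ for $e\in E_1$, $\alpha(e)=B$ for $e\in E_2$, and $\big||E_1|-|E_2|\big|\le 1$. A graph $G$ is balanceable if there is an $n_0$ such that for every $n\ge n_0$ there exists an integer $m$ with $0\le m<\lfloor \frac12\binom n2\rfloor$ such that every 2-coloring $\alpha$ of $E(K_n)$ with $|\alpha^{ -1}(R)|>m$ and $|\alpha^{ -1}(B)|>m$ contains a balanced copy of $G$. -}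

module Defs where

open import Data.Fin as Fin using (Fin)
import Data.Fin.Properties as Finₚ
open import Data.Fin.Subset as Subset using (Subset)
open import Data.List using (List; []; _∷_; _++_; length; filter; allFin; upTo; cartesianProduct)
open import Data.List.Membership.Propositional using (_∈_)
open import Data.List.Membership.Propositional.Properties using (∈-allFin; ∈-upTo⁺; ∈-cartesianProduct⁺)
open import Data.List.Relation.Binary.Permutation.Propositional using (_↭_)
open import Data.List.Relation.Unary.All as All using (All; []; _∷_)
open import Data.List.Relation.Unary.AllPairs using ([]; _∷_)
open import Data.List.Relation.Unary.Any using (here; there)
open import Data.List.Relation.Unary.Enumerates.Setoid using (IsEnumeration)
open import Data.List.Relation.Unary.Unique.Propositional using (Unique)
import Data.List.Relation.Unary.Unique.Propositional.Properties as Uniqueₚ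
open import Data.Nat using (ℕ; suc; _≤_; _<_; _≥_; _≤?_; _≟_; s≤s; ⌊_/2⌋; ∣_-_∣)
open import Data.Nat.Combinatorics using (_C_)
open import Data.Nat.Properties using (≤-trans; ≤-irrelevant; 1+n≢n)
open import Data.Product using (Σ; ∃; ∃-syntax; _×_; _,_; proj₁; proj₂; uncurry)
import Data.Product.Properties as Productₚ
open import Data.Sum using (_⊎_; inj₁; inj₂)
open import Function.Bundles using (_⇔_)
open import Function.Definitions using (Injective)
open import Level using (0ℓ)
open import Relation.Binary using (Rel; Symmetric; DecidableEquality)
import Relation.Binary as Binary
open import Relation.Binary.Construct.Closure.Symmetric using (SymClosure; fwd; bwd; symmetric)
open import Relation.Binary.PropositionalEquality using (_≡_; refl; sym; cong; setoid)
open import Relation.Nullary using (¬_; yes; no; contradiction)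
open import Relation.Nullary.Decidable using (map′; _×-dec_; _⊎-dec_)
open import Relation.Unary using (Pred)
import Relation.Unary as Unary
import Relation.Nullary as Nullary

module _ {A : Set} {P : Pred A 0ℓ} (P? : Unary.Decidable P) where

  select : List A → List (∃ P)
  select [] = []
  select (x ∷ xs) with P? x
  ... | yes p = (x , p) ∷ select xs
  ... | no _  = select xs

  ∈-select : (∀ {x} → Nullary.Irrelevant (P x)) →
             ∀ {x xs} → x ∈ xs → (p : P x) → (x , p) ∈ select xs
  ∈-select irr {x} (here {xs = xs} refl) p with P? x
  ... | yes q = here (cong (x ,_) (irr p q))
  ... | no ¬p = contradiction p ¬p
  ∈-select irr (there {x = y} x∈xs) p with P? y
  ... | yes _ = there (∈-select irr x∈xs p)
  ... | no _  = ∈-select irr x∈xs p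

  select-All : ∀ {Q : Pred A 0ℓ} {xs} → All Q xs → All (λ y → Q (proj₁ y)) (select xs)
  select-All [] = []
  select-All {xs = x ∷ _} (q ∷ qs) with P? x
  ... | yes _ = q ∷ select-All qs
  ... | no _  = select-All qs

  select-unique : ∀ {xs} → Unique xs → Unique (select xs)
  select-unique [] = []
  select-unique {x ∷ _} (x∉xs ∷ xs!) with P? x
  ... | yes _ = All.map (λ { x≢y refl → x≢y refl }) (select-All x∉xs) ∷ select-unique xs!
  ... | no _  = select-unique xs!

record Graph : Set₁ where
  infix 4 _~_ _~?_
  field
    Vertex       : Set
    _≟ᵛ_         : DecidableEquality Vertex
    vertices     : List Vertex
    vertices-all : IsEnumeration (setoid Vertex) vertices
    _~_          : Rel Vertex 0ℓ
    _~?_         : Binary.Decidable _~_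
    ~-sym        : Symmetric _~_
    ~-irrefl     : ∀ {v} → ¬ v ~ v

-- The complete graph Kₙ on Fin n: the edge {x , y} is represented by its
-- ordered pair of endpoints, smaller endpoint first.

Edge : ℕ → Set
Edge n = Σ (Fin n × Fin n) (uncurry Fin._<_)

module _ {n : ℕ} where

  lo hi : Edge n → Fin n
  lo e = proj₁ (proj₁ e)
  hi e = proj₂ (proj₁ e)

  Joins : Edge n → Fin n → Fin n → Set
  Joins e x y = (lo e ≡ x × hi e ≡ y) ⊎ (lo e ≡ y × hi e ≡ x)

edges : ∀ n → List (Edge n)
edges n = select (uncurry Fin._<?_) (cartesianProduct (allFin n) (allFin n))

edges-all : ∀ n → IsEnumeration (setoid (Edge n)) (edges n)
edges-all n ((i , j) , i<j) =
  ∈-select _ (Finₚ.<-irrelevant) (∈-cartesianProduct⁺ (∈-allFin i) (∈-allFin j)) i<j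

edges-unique : ∀ n → Unique (edges n)
edges-unique n =
  select-unique _ (Uniqueₚ.cartesianProduct⁺ (Uniqueₚ.allFin⁺ n) (Uniqueₚ.allFin⁺ n))

record Subgraph (n : ℕ) : Set where
  field
    V        : Subset n
    E        : List (Edge n)
    E-unique : Unique E
    E⊆V      : ∀ {e} → e ∈ E → lo e Subset.∈ V × hi e Subset.∈ V

  Adjacent : Rel (Fin n) 0ℓ
  Adjacent x y = ∃[ e ] (e ∈ E × Joins e x y)

record _≅_ (G : Graph) {n : ℕ} (H : Subgraph n) : Set where
  open Graph G
  open Subgraph H
  field
    to         : Vertex → Fin n
    to-∈       : ∀ u → to u Subset.∈ V
    injective  : Injective _≡_ _≡_ to
    surjective : ∀ {x} → x Subset.∈ V → ∃[ u ] to u ≡ x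
    adjacency  : ∀ u v → u ~ v ⇔ Adjacent (to u) (to v)

data Colour : Set where
  red blue : Colour

_≟ᶜ_ : DecidableEquality Colour
red  ≟ᶜ red  = yes refl
red  ≟ᶜ blue = no λ ()
blue ≟ᶜ red  = no λ ()
blue ≟ᶜ blue = yes refl

Colouring : ℕ → Set
Colouring n = Edge n → Colour

count : ∀ {n} → Colouring n → Colour → ℕ
count {n} α c = length (filter (λ e → α e ≟ᶜ c) (edges n))

-- Edge sets are duplicate-free lists, so E₁ ++ E₂ ↭ E says that E is the
-- disjoint union of E₁ and E₂.

record BalancedCopy (G : Graph) {n : ℕ} (α : Colouring n) : Set where
  field
    H         : Subgraph n
    G≅H       : G ≅ H
    E₁ E₂     : List (Edge n)
    partition : E₁ ++ E₂ ↭ Subgraph.E H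
    E₁-red    : All (λ e → α e ≡ red) E₁
    E₂-blue   : All (λ e → α e ≡ blue) E₂
    balanced  : ∣ length E₁ - length E₂ ∣ ≤ 1

Balanceable : Graph → Set
Balanceable G =
  ∃[ n₀ ] ∀ n → n ≥ n₀ →
    ∃[ m ] (m < ⌊ n C 2 /2⌋ ×
            ((α : Colouring n) → m < count α red → m < count α blue → BalancedCopy G α))

-- The pair (i , j) stands for the vertex uᵢʲ of the triangular grid.

InGrid : ℕ → Pred (ℕ × ℕ) 0ℓ
InGrid h (i , j) = 1 ≤ i × i ≤ j × j ≤ h

GridVertex : ℕ → Set
GridVertex h = Σ (ℕ × ℕ) (InGrid h)

inGrid? : ∀ h → Unary.Decidable (InGrid h)
inGrid? h (i , j) = 1 ≤? i ×-dec i ≤? j ×-dec j ≤? h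

inGrid-irrelevant : ∀ {h p} → Nullary.Irrelevant (InGrid h p)
inGrid-irrelevant (a , b , c) (a′ , b′ , c′)
  rewrite ≤-irrelevant a a′ | ≤-irrelevant b b′ | ≤-irrelevant c c′ = refl

-- The index ranges of the three families of edges are exactly the conditions
-- for both endpoints to lie in the grid.
data Step : Rel (ℕ × ℕ) 0ℓ where
  horizontal : ∀ {i j} → Step (i , j) (suc i , j)
  downLeft   : ∀ {i j} → Step (i , j) (i , suc j)
  downRight  : ∀ {i j} → Step (i , j) (suc i , suc j)

step? : Binary.Decidable Step
step? (i , j) (k , l) = map′ to from
  ((k ≟ suc i ×-dec l ≟ j) ⊎-dec (k ≟ i ×-dec l ≟ suc j) ⊎-dec (k ≟ suc i ×-dec l ≟ suc j))
  where
  Cases = (k ≡ suc i × l ≡ j) ⊎ (k ≡ i × l ≡ suc j) ⊎ (k ≡ suc i × l ≡ suc j)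

  to : Cases → Step (i , j) (k , l)
  to (inj₁ (refl , refl))        = horizontal
  to (inj₂ (inj₁ (refl , refl))) = downLeft
  to (inj₂ (inj₂ (refl , refl))) = downRight

  from : Step (i , j) (k , l) → Cases
  from horizontal = inj₁ (refl , refl)
  from downLeft   = inj₂ (inj₁ (refl , refl))
  from downRight  = inj₂ (inj₂ (refl , refl))

step-irrefl : ∀ {p q} → p ≡ q → ¬ Step p q
step-irrefl eq horizontal = 1+n≢n (sym (cong proj₁ eq))
step-irrefl eq downLeft   = 1+n≢n (sym (cong proj₂ eq))
step-irrefl eq downRight  = 1+n≢n (sym (cong proj₁ eq))

T : ℕ → Graph
T h = record
  { Vertex       = GridVertex h
  ; _≟ᵛ_         = Productₚ.≡-dec (Productₚ.≡-dec _≟_ _≟_) λ p q → yes (inGrid-irrelevant p q)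
  ; vertices     = select (inGrid? h) (cartesianProduct (upTo (suc h)) (upTo (suc h)))
  ; vertices-all = λ { ((i , j) , p@(1≤i , i≤j , j≤h)) →
      ∈-select (inGrid? h) inGrid-irrelevant
        (∈-cartesianProduct⁺ (∈-upTo⁺ (s≤s (≤-trans i≤j j≤h))) (∈-upTo⁺ (s≤s j≤h))) p }
  ; _~_          = λ u v → SymClosure Step (proj₁ u) (proj₁ v)
  ; _~?_         = λ u v → map′ (λ { (inj₁ s) → fwd s ; (inj₂ s) → bwd s })
                                (λ { (fwd s) → inj₁ s ; (bwd s) → inj₂ s })
                                (step? (proj₁ u) (proj₁ v) ⊎-dec step? (proj₁ v) (proj₁ u))
  ; ~-sym        = symmetric Step
  ; ~-irrefl     = λ { (fwd s) → step-irrefl refl s ; (bwd s) → step-irrefl refl s }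
  }

{-# OPTIONS --safe #-}
module Submission where

-- The upward triangles partition the edges of T h. A cut meets each of them in 0 or 2 edges, so it
-- cannot contain exactly half of the edges when that half is odd, which happens for h ≡ 4, 5 (mod 8);
-- the colouring of K_{k²} by a cut of exactly half its edges then has no balanced copy.
-- For h ≡ 0, 1 (mod 8), T h has a cut containing half of its edges and a set of vertices inducing half
-- of its edges. A large complete graph with both colour classes of half size contains one of two
-- patterns in which such a vertex set or cut is a balanced copy: Ramsey gives a c-clique, density gives
-- a large complete bipartite graph in the other colour, and Ramsey in its two parts gives either
-- c-cliques joined by the other colour, or a clique of the other colour. In the second case a large
-- homogeneous bipartite piece between the two opposite cliques is the pattern.

open import Defs
open import Data.Bool using (Bool; true; false; not; _∧_; _∨_; _xor_; if_then_else_)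
open import Data.Bool.Properties using (xor-comm; ∧-zeroʳ)
open import Data.Fin as Fin using (Fin; toℕ)
import Data.Fin.Properties as Finₚ
open import Data.Fin.Subset as Subset using (Subset)
open import Data.List using (List; []; _∷_; _++_; length; map; filter; take; tabulate; downFrom; allFin; lookup; cartesianProduct)
open import Data.List.Properties using (map-tabulate; length-++; length-take; length-tabulate; length-downFrom; filter-++; filter-all; filter-none; ++-identityʳ)
import Data.List.Membership.DecPropositional as DecMembership
open import Data.List.Membership.Propositional using (_∈_)
open import Data.List.Membership.Propositional.Properties using (∈-map⁺; ∈-map⁻; ∈-++⁺ˡ; ∈-++⁺ʳ; ∈-++⁻; ∈-downFrom⁺; ∈-downFrom⁻; ∈-filter⁻; ∈-lookup)
open import Data.List.Membership.Propositional.Properties.WithK using (unique∧set⇒bag)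
open import Data.List.Relation.Binary.BagAndSetEquality using (∼bag⇒↭)
open import Data.List.Relation.Binary.Permutation.Propositional using (_↭_; ↭-refl; ↭-trans; prep)
open import Data.List.Relation.Binary.Permutation.Propositional.Properties using (shift; ↭-length; filter-↭)
open import Data.List.Relation.Binary.Pointwise as Pointwise using (Pointwise; []; _∷_)
open import Data.List.Relation.Binary.Sublist.Propositional as Sublist using (_⊆_; []; _∷_; _∷ʳ_; ⊆-refl; ⊆-trans)
open import Data.List.Relation.Binary.Sublist.Propositional.Properties using (filter-⊆; All-resp-⊆; take-⊆)
open import Data.List.Relation.Unary.All as All using (All; []; _∷_)
open import Data.List.Relation.Unary.All.Properties using (all-filter)
open import Data.List.Relation.Unary.AllPairs using (AllPairs; []; _∷_)
import Data.List.Relation.Unary.AllPairs.Properties as AllPairsₚ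
open import Data.List.Relation.Unary.Any using (here; there)
open import Data.List.Relation.Unary.Unique.Propositional using (Unique)
import Data.List.Relation.Unary.Unique.Propositional.Properties as Uniqueₚ
open import Data.Nat
open import Data.Nat.Combinatorics using (_C_; nC1≡n; nCk+nC[k+1]≡[n+1]C[k+1])
open import Data.Nat.DivMod using (_mod_; m<n⇒m%n≡m; m%n<n; m≡m%n+[m/n]*n)
open import Data.Nat.Properties
open import Data.Nat.Tactic.RingSolver using (solve-∀)
open import Data.Product using (∃; ∃-syntax; _×_; _,_; proj₁; proj₂; uncurry)
open import Data.Sum as Sum using (_⊎_; inj₁; inj₂; [_,_]′)
open import Data.Vec as Vec using ()
import Data.Vec.Properties as Vecₚ
open import Function using (_∘_; id; const; flip; mk⇔; Equivalence)
open import Function.Bundles using (_⇔_)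
open import Level using (0ℓ)
open import Relation.Binary using (tri<; tri≈; tri>; Symmetric)
import Relation.Binary as Binary
open import Relation.Binary.Construct.Closure.Symmetric using (SymClosure; fwd; bwd)
open import Relation.Binary.PropositionalEquality
open import Relation.Nullary using (¬_; yes; no; does; contradiction; ¬?)
open import Relation.Nullary.Decidable using (dec-true; dec-false)
open import Relation.Unary using (Pred; Decidable)

-- `T h` has `3 * tri h` edges, where `tri h` counts its upward triangles, and `tri` modulo 4
-- depends only on `h` modulo 8. Grids appear as `T (suc m)` because the vertices of the last row
-- are tops of no upward triangle. Two kinds of halving are needed because neither pattern is
-- unavoidable by itself: if the red edges form a clique, there is no large pattern of the cut kind,
-- and if they form a cut, there is none of the induced kind. Both halvings are exact, so a pattern
-- serves with either assignment of the two colours. This is why the symmetric cut pattern and the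
-- asymmetric clique pattern can be treated alike, through a Boolean operation `β`: `_xor_` for cuts
-- and `_∧_` for induced edges.

private variable
  A B : Set

-- Finite sums and triangular numbers

∑ : (A → ℕ) → List A → ℕ
∑ f []       = 0
∑ f (x ∷ xs) = f x + ∑ f xs

⟦_⟧ : Bool → ℕ
⟦ true ⟧  = 1
⟦ false ⟧ = 0

∑-cong-∈ : ∀ {f g : A → ℕ} xs → (∀ {x} → x ∈ xs → f x ≡ g x) → ∑ f xs ≡ ∑ g xs
∑-cong-∈ []       eq = refl
∑-cong-∈ (x ∷ xs) eq = cong₂ _+_ (eq (here refl)) (∑-cong-∈ xs (eq ∘ there))

∑-cong : ∀ {f g : A → ℕ} → (∀ x → f x ≡ g x) → ∀ xs → ∑ f xs ≡ ∑ g xs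
∑-cong eq xs = ∑-cong-∈ xs λ {x} _ → eq x

∑-mono-∈ : ∀ {f g : A → ℕ} xs → (∀ {x} → x ∈ xs → f x ≤ g x) → ∑ f xs ≤ ∑ g xs
∑-mono-∈ []       le = z≤n
∑-mono-∈ (x ∷ xs) le = +-mono-≤ (le (here refl)) (∑-mono-∈ xs (le ∘ there))

∑-const : ∀ c (xs : List A) → ∑ (const c) xs ≡ length xs * c
∑-const c []       = refl
∑-const c (x ∷ xs) = cong (c +_) (∑-const c xs)

∑-++ : ∀ (f : A → ℕ) xs ys → ∑ f (xs ++ ys) ≡ ∑ f xs + ∑ f ys
∑-++ f []       ys = refl
∑-++ f (x ∷ xs) ys = trans (cong (f x +_) (∑-++ f xs ys)) (sym (+-assoc (f x) _ _))

∑-map : ∀ (f : B → ℕ) (g : A → B) xs → ∑ f (map g xs) ≡ ∑ (f ∘ g) xs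
∑-map f g []       = refl
∑-map f g (x ∷ xs) = cong (f (g x) +_) (∑-map f g xs)

interchange : ∀ a b c d → (a + b) + (c + d) ≡ (a + c) + (b + d)
interchange = solve-∀

∑-+ : ∀ (f g : A → ℕ) xs → ∑ (λ x → f x + g x) xs ≡ ∑ f xs + ∑ g xs
∑-+ f g []       = refl
∑-+ f g (x ∷ xs) = trans (cong (f x + g x +_) (∑-+ f g xs)) (interchange (f x) (g x) _ _)

∑-*ˡ : ∀ c (f : A → ℕ) xs → ∑ (λ x → c * f x) xs ≡ c * ∑ f xs
∑-*ˡ c f []       = sym (*-zeroʳ c)
∑-*ˡ c f (x ∷ xs) = trans (cong (c * f x +_) (∑-*ˡ c f xs)) (sym (*-distribˡ-+ c (f x) _))

∑-swap : ∀ (f : A → B → ℕ) xs ys →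
         ∑ (λ x → ∑ (f x) ys) xs ≡ ∑ (λ y → ∑ (λ x → f x y) xs) ys
∑-swap f []       ys = sym (trans (∑-const 0 ys) (*-zeroʳ (length ys)))
∑-swap f (x ∷ xs) ys = trans (cong (∑ (f x) ys +_) (∑-swap f xs ys)) (sym (∑-+ (f x) _ ys))

∑-cartesianProduct : ∀ (f : A × B → ℕ) xs ys →
                     ∑ f (cartesianProduct xs ys) ≡ ∑ (λ x → ∑ (λ y → f (x , y)) ys) xs
∑-cartesianProduct f []       ys = refl
∑-cartesianProduct f (x ∷ xs) ys =
  trans (∑-++ f (map (x ,_) ys) _) (cong₂ _+_ (∑-map f (x ,_) ys) (∑-cartesianProduct f xs ys))

length-filter : ∀ {P : Pred A 0ℓ} (P? : Decidable P) xs →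
                length (filter P? xs) ≡ ∑ (λ x → ⟦ does (P? x) ⟧) xs
length-filter P? []       = refl
length-filter P? (x ∷ xs) with does (P? x)
... | true  = cong suc (length-filter P? xs)
... | false = length-filter P? xs

-- Extension by zero: it turns a sum over edges into a double sum over all ordered pairs of
-- vertices.
selected : {P : Pred A 0ℓ} → Decidable P → (∃ P → ℕ) → A → ℕ
selected P? f x with P? x
... | yes p = f (x , p)
... | no _  = 0

∑-select : ∀ {P : Pred A 0ℓ} (P? : Decidable P) (f : ∃ P → ℕ) xs →
           ∑ f (select P? xs) ≡ ∑ (selected P? f) xs
∑-select P? f []       = refl
∑-select P? f (x ∷ xs) with P? x
... | yes p = cong (f (x , p) +_) (∑-select P? f xs)
... | no _  = ∑-select P? f xs

∑-downFrom-suc : ∀ (f : ℕ → ℕ) n → ∑ f (downFrom (suc n)) ≡ f 0 + ∑ (f ∘ suc) (downFrom n)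
∑-downFrom-suc f zero    = refl
∑-downFrom-suc f (suc n) =
  trans (cong (f (suc n) +_) (∑-downFrom-suc f n)) (swap (f (suc n)) (f 0) _)
  where
  swap : ∀ a b c → a + (b + c) ≡ b + (a + c)
  swap = solve-∀

∑-allFin : ∀ (f : ℕ → ℕ) n → ∑ (f ∘ toℕ) (allFin n) ≡ ∑ f (downFrom n)
∑-allFin f zero    = refl
∑-allFin f (suc n) = trans (cong (f 0 +_)
    (trans (cong (∑ (f ∘ toℕ {suc n})) (sym (map-tabulate {n = n} id Fin.suc)))
    (trans (∑-map (f ∘ toℕ) Fin.suc (allFin n)) (∑-allFin (f ∘ suc) n))))
  (sym (∑-downFrom-suc f n))

∑-below : ∀ {a n} → a ≤ n → ∑ (λ i → ⟦ i <ᵇ a ⟧) (downFrom n) ≡ a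
∑-below {zero}  {n}     _         = trans (∑-const 0 (downFrom n)) (*-zeroʳ (length (downFrom n)))
∑-below {suc a} {suc n} (s≤s a≤n) = trans (∑-downFrom-suc (λ i → ⟦ i <ᵇ suc a ⟧) n) (cong suc (∑-below a≤n))

-- Indexed so that tri n = n(n − 1)/2.
tri : ℕ → ℕ
tri n = ∑ id (downFrom n)

-- A pair of points lies in the first part, in the second part, or across.
tri-+ : ∀ m n → tri (m + n) ≡ tri m + tri n + m * n
tri-+ zero    n = sym (+-identityʳ (tri n))
tri-+ (suc m) n = trans (cong (m + n +_) (tri-+ m n)) (rearrange m n (tri m) (tri n))
  where
  rearrange : ∀ m n s t → m + n + (s + t + m * n) ≡ m + s + t + (n + m * n)
  rearrange = solve-∀

2*tri+n≡n² : ∀ n → 2 * tri n + n ≡ n * n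
2*tri+n≡n² zero    = refl
2*tri+n≡n² (suc n) = trans (rearrange n (tri n)) (trans (cong (λ x → suc (n + n + x)) (2*tri+n≡n² n)) (square n))
  where
  rearrange : ∀ n t → 2 * (n + t) + suc n ≡ suc (n + n + (2 * t + n))
  rearrange = solve-∀
  square : ∀ n → suc (n + n + n * n) ≡ suc n * suc n
  square = solve-∀

tri-mono : ∀ {m n} → m ≤ n → tri m ≤ tri n
tri-mono {zero}          _         = z≤n
tri-mono {suc m} {suc n} (s≤s m≤n) = +-mono-≤ m≤n (tri-mono m≤n)

nC2≡tri : ∀ n → n C 2 ≡ tri n
nC2≡tri zero    = refl
nC2≡tri (suc n) = trans (sym (nCk+nC[k+1]≡[n+1]C[k+1] n 1)) (cong₂ _+_ (nC1≡n n) (nC2≡tri n))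

⟦not⟧ : ∀ b → ⟦ b ⟧ + ⟦ not b ⟧ ≡ 1
⟦not⟧ true  = refl
⟦not⟧ false = refl

-- The triangular grid

Point : Set
Point = ℕ × ℕ

-- The upward triangles partition the edges of the grid; each is represented by its top vertex.
triangles : ℕ → List Point
triangles zero    = []
triangles (suc m) = map (λ i → suc i , suc m) (downFrom (suc m)) ++ triangles m

left right base : Point → Point × Point
left  (i , j) = (i , j) , (i , suc j)
right (i , j) = (i , j) , (suc i , suc j)
base  (i , j) = (i , suc j) , (suc i , suc j)

-- These are the edges of T (suc m), not of T m.
gridEdges : ℕ → List (Point × Point)
gridEdges m = map left (triangles m) ++ map right (triangles m) ++ map base (triangles m)

∈-triangles⁺ : ∀ {i j m} → 1 ≤ i → i ≤ j → j ≤ m → (i , j) ∈ triangles m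
∈-triangles⁺ {m = zero}  1≤i i≤j j≤m = contradiction (≤-trans 1≤i (≤-trans i≤j j≤m)) λ ()
∈-triangles⁺ {suc i} {j} {suc m} 1≤i i≤j j≤m with j ≟ suc m
... | yes refl = ∈-++⁺ˡ (∈-map⁺ _ (∈-downFrom⁺ i≤j))
... | no  j≢   = ∈-++⁺ʳ _ (∈-triangles⁺ 1≤i i≤j (s≤s⁻¹ (≤∧≢⇒< j≤m j≢)))

∈-triangles⁻ : ∀ {i j} m → (i , j) ∈ triangles m → 1 ≤ i × i ≤ j × j ≤ m
∈-triangles⁻ (suc m) p∈ with ∈-++⁻ (map (λ i → suc i , suc m) (downFrom (suc m))) p∈
... | inj₂ p∈′ with ∈-triangles⁻ m p∈′
...   | 1≤i , i≤j , j≤m = 1≤i , i≤j , m≤n⇒m≤1+n j≤m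
∈-triangles⁻ (suc m) p∈ | inj₁ p∈′ with ∈-map⁻ _ p∈′
...   | i , i∈ , refl = s≤s z≤n , ∈-downFrom⁻ i∈ , ≤-refl

triangles-unique : ∀ m → Unique (triangles m)
triangles-unique zero    = []
triangles-unique (suc m) =
  Uniqueₚ.++⁺ (Uniqueₚ.map⁺ (λ { refl → refl }) (Uniqueₚ.downFrom⁺ (suc m))) (triangles-unique m) disjoint
  where
  disjoint : ∀ {p} → ¬ (p ∈ map (λ i → suc i , suc m) (downFrom (suc m)) × p ∈ triangles m)
  disjoint (p∈row , p∈) with ∈-map⁻ _ p∈row
  ... | _ , _ , refl = <-irrefl refl (proj₂ (proj₂ (∈-triangles⁻ m p∈)))

gridEdges-unique : ∀ m → Unique (gridEdges m)
gridEdges-unique m =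
  Uniqueₚ.++⁺ (Uniqueₚ.map⁺ (λ { refl → refl }) t!)
    (Uniqueₚ.++⁺ (Uniqueₚ.map⁺ (λ { refl → refl }) t!) (Uniqueₚ.map⁺ (λ { refl → refl }) t!) right≢base)
    left≢
  where
  t! = triangles-unique m
  right≢base : ∀ {e} → ¬ (e ∈ map right (triangles m) × e ∈ map base (triangles m))
  right≢base (r , b) with ∈-map⁻ right r | ∈-map⁻ base b
  ... | _ , _ , refl | _ , _ , ()
  left≢ : ∀ {e} → ¬ (e ∈ map left (triangles m) × e ∈ map right (triangles m) ++ map base (triangles m))
  left≢ (l , rb) with ∈-map⁻ left l | ∈-++⁻ (map right (triangles m)) rb
  left≢ (l , rb) | _ , _ , refl | inj₁ r with ∈-map⁻ right r
  ... | _ , _ , ()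
  left≢ (l , rb) | _ , _ , refl | inj₂ b with ∈-map⁻ base b
  ... | _ , _ , ()

∈-gridEdges⁺ : ∀ {m p q} → InGrid (suc m) p → InGrid (suc m) q → Step p q → (p , q) ∈ gridEdges m
∈-gridEdges⁺ (1≤i , i≤j , j≤h) (_ , _ , l≤h) downLeft =
  ∈-++⁺ˡ (∈-map⁺ left (∈-triangles⁺ 1≤i i≤j (s≤s⁻¹ l≤h)))
∈-gridEdges⁺ {m} (1≤i , i≤j , j≤h) (_ , _ , l≤h) downRight =
  ∈-++⁺ʳ (map left (triangles m)) (∈-++⁺ˡ (∈-map⁺ right (∈-triangles⁺ 1≤i i≤j (s≤s⁻¹ l≤h))))
-- A horizontal edge never lies in the first row; it is the base of the triangle whose top is one
-- row higher.
∈-gridEdges⁺ {m} {_ , suc j} (1≤i , i≤j , j≤h) (_ , i<j , _) horizontal =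
  ∈-++⁺ʳ (map left (triangles m)) (∈-++⁺ʳ (map right (triangles m))
    (∈-map⁺ base (∈-triangles⁺ 1≤i (s≤s⁻¹ i<j) (s≤s⁻¹ j≤h))))

∈-gridEdges⁻ : ∀ {p q} m → (p , q) ∈ gridEdges m → InGrid (suc m) p × InGrid (suc m) q × Step p q
∈-gridEdges⁻ m e∈ with ∈-++⁻ (map left (triangles m)) e∈
∈-gridEdges⁻ m e∈ | inj₁ l with ∈-map⁻ left l
... | _ , t∈ , refl with ∈-triangles⁻ m t∈
...   | 1≤i , i≤j , j≤m = (1≤i , i≤j , m≤n⇒m≤1+n j≤m) , (1≤i , m≤n⇒m≤1+n i≤j , s≤s j≤m) , downLeft
∈-gridEdges⁻ m e∈ | inj₂ rb with ∈-++⁻ (map right (triangles m)) rb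
∈-gridEdges⁻ m e∈ | inj₂ rb | inj₁ r with ∈-map⁻ right r
... | _ , t∈ , refl with ∈-triangles⁻ m t∈
...   | 1≤i , i≤j , j≤m = (1≤i , i≤j , m≤n⇒m≤1+n j≤m) , (s≤s z≤n , s≤s i≤j , s≤s j≤m) , downRight
∈-gridEdges⁻ m e∈ | inj₂ rb | inj₂ b with ∈-map⁻ base b
... | _ , t∈ , refl with ∈-triangles⁻ m t∈
...   | 1≤i , i≤j , j≤m = (1≤i , m≤n⇒m≤1+n i≤j , s≤s j≤m) , (s≤s z≤n , s≤s i≤j , s≤s j≤m) , horizontal

-- Regrouping by triangle serves two purposes: cuts are counted triangle by triangle, and splits are
-- built one row of triangles at a time.
∑-gridEdges : ∀ (f : Point × Point → ℕ) m →
              ∑ f (gridEdges m) ≡ ∑ (λ t → f (left t) + (f (right t) + f (base t))) (triangles m)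
∑-gridEdges f m = begin
  ∑ f (gridEdges m)
    ≡⟨ ∑-++ f (map left t) _ ⟩
  ∑ f (map left t) + ∑ f (map right t ++ map base t)
    ≡⟨ cong₂ _+_ (∑-map f left t) (trans (∑-++ f (map right t) _) (cong₂ _+_ (∑-map f right t) (∑-map f base t))) ⟩
  ∑ (f ∘ left) t + (∑ (f ∘ right) t + ∑ (f ∘ base) t)
    ≡⟨ cong (∑ (f ∘ left) t +_) (∑-+ (f ∘ right) (f ∘ base) t) ⟨
  ∑ (f ∘ left) t + ∑ (λ x → f (right x) + f (base x)) t
    ≡⟨ ∑-+ (f ∘ left) _ t ⟨
  ∑ (λ x → f (left x) + (f (right x) + f (base x))) t ∎
  where
  open ≡-Reasoning
  t = triangles m

∑-const-1 : ∀ {A : Set} (xs : List A) → ∑ (const 1) xs ≡ length xs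
∑-const-1 xs = trans (∑-const 1 xs) (*-identityʳ _)

length-triangles : ∀ m → ∑ (const 1) (triangles m) ≡ tri (suc m)
length-triangles zero    = refl
length-triangles (suc m) =
  trans (∑-++ (const 1) (map (λ i → suc i , suc m) (downFrom (suc m))) (triangles m))
    (cong₂ _+_ (trans (∑-map (const 1) (λ i → suc i , suc m) (downFrom (suc m))) (trans (∑-const-1 (downFrom (suc m))) (length-downFrom (suc m)))) (length-triangles m))

length-gridEdges : ∀ m → length (gridEdges m) ≡ 3 * tri (suc m)
length-gridEdges m = begin
  length (gridEdges m)          ≡⟨ ∑-const-1 (gridEdges m) ⟨
  ∑ (const 1) (gridEdges m)     ≡⟨ ∑-gridEdges (const 1) m ⟩
  ∑ (const (3 * 1)) (triangles m)     ≡⟨ ∑-*ˡ 3 (const 1) (triangles m) ⟩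
  3 * ∑ (const 1) (triangles m) ≡⟨ cong (3 *_) (length-triangles m) ⟩
  3 * tri (suc m)               ∎
  where open ≡-Reasoning

-- Splits of the grid with a prescribed number of edges

module _ (β : Bool → Bool → Bool) where

  weight : (Point → Bool) → Point × Point → ℕ
  weight s (p , q) = ⟦ β (s p) (s q) ⟧

  -- The contribution of the `m` upward triangles with tops in row `m`, when `ρ` gives the sides on
  -- that row and `ρ′` those on the next.
  rowWeight : ℕ → (ℕ → Bool) → (ℕ → Bool) → ℕ
  rowWeight m ρ ρ′ = ∑ (λ i → ⟦ β (ρ (suc i)) (ρ′ (suc i)) ⟧
                           + (⟦ β (ρ (suc i)) (ρ′ (suc (suc i))) ⟧
                           +  ⟦ β (ρ′ (suc i)) (ρ′ (suc (suc i))) ⟧)) (downFrom m)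

  -- A choice of sides of T (suc m) with v edges whose two sides are related by β.
  record Reach (m : ℕ) (ρ : ℕ → Bool) (v : ℕ) : Set where
    constructor reach
    field
      side     : Point → Bool
      last-row : ∀ i → side (i , suc m) ≡ ρ i
      total    : ∑ (weight side) (gridEdges m) ≡ v

  reach-first : ∀ ρ → Reach 0 ρ 0
  reach-first ρ = reach (λ (i , _) → ρ i) (λ _ → refl) refl

  -- The new triangles touch only the former last row and the new one, so the sides on the last row
  -- are all that has to be remembered.
  reach-next : ∀ {m ρ v} → Reach m ρ v → ∀ ρ′ → Reach (suc m) ρ′ (rowWeight (suc m) ρ ρ′ + v)
  reach-next {m} {ρ} {v} (reach s last sum) ρ′ = reach s′ last′ sum′
    where
    s′ : Point → Bool
    s′ (i , j) = if does (j ≟ suc (suc m)) then ρ′ i else s (i , j)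

    last′ : ∀ i → s′ (i , suc (suc m)) ≡ ρ′ i
    last′ i rewrite dec-true (suc (suc m) ≟ suc (suc m)) refl = refl

    old : ∀ {j} i → j ≤ suc m → s′ (i , j) ≡ s (i , j)
    old {j} i j≤ rewrite dec-false (j ≟ suc (suc m)) (λ j≡ → <-irrefl j≡ (s≤s j≤)) = refl

    last-old : ∀ i → s′ (i , suc m) ≡ ρ i
    last-old i = trans (old i ≤-refl) (last i)

    tw : (Point → Bool) → Point → ℕ
    tw r t = weight r (left t) + (weight r (right t) + weight r (base t))

    sum-old : ∀ {t} → t ∈ triangles m → tw s′ t ≡ tw s t
    sum-old {i , j} t∈ with ∈-triangles⁻ m t∈
    ... | _ , _ , j≤m
      rewrite old i (m≤n⇒m≤1+n j≤m) | old i (s≤s j≤m) | old (suc i) (s≤s j≤m) = refl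

    sum-new : ∀ i → tw s′ (suc i , suc m) ≡ _
    sum-new i rewrite last-old (suc i) | last′ (suc i) | last′ (suc (suc i)) = refl

    sum′ : ∑ (weight s′) (gridEdges (suc m)) ≡ rowWeight (suc m) ρ ρ′ + v
    sum′ = begin
      ∑ (weight s′) (gridEdges (suc m))
        ≡⟨ ∑-gridEdges (weight s′) (suc m) ⟩
      ∑ (tw s′) (triangles (suc m))
        ≡⟨ ∑-++ (tw s′) (map (λ i → suc i , suc m) (downFrom (suc m))) (triangles m) ⟩
      ∑ (tw s′) (map (λ i → suc i , suc m) (downFrom (suc m))) + ∑ (tw s′) (triangles m)
        ≡⟨ cong₂ _+_ (trans (∑-map (tw s′) (λ i → suc i , suc m) (downFrom (suc m))) (∑-cong sum-new (downFrom (suc m))))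
                     (∑-cong-∈ (triangles m) sum-old) ⟩
      rowWeight (suc m) ρ ρ′ + ∑ (tw s) (triangles m)
        ≡⟨ cong (rowWeight (suc m) ρ ρ′ +_) (trans (sym (∑-gridEdges (weight s) m)) sum) ⟩
      rowWeight (suc m) ρ ρ′ + v ∎
      where open ≡-Reasoning

reach-≡ : ∀ {β m ρ v w} → v ≡ w → Reach β m ρ v → Reach β m ρ w
reach-≡ refl r = r

-- For `_xor_` a cut with half of the edges, for `_∧_` a vertex set inducing half of them.
HalfSplit : (Bool → Bool → Bool) → ℕ → Set
HalfSplit β m = ∃[ s ] 2 * ∑ (weight β s) (gridEdges m) ≡ length (gridEdges m)

rowWeight-const : ∀ β m b b′ → rowWeight β m (const b) (const b′) ≡ m * (⟦ β b b′ ⟧ + (⟦ β b b′ ⟧ + ⟦ β b′ b′ ⟧))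
rowWeight-const β m b b′ = trans (∑-const _ (downFrom m)) (cong (_* _) (length-downFrom m))

-- Two consecutive rows on the same side leave the triangles between them uncut, so the number of cut
-- triangles can be any sum of a subset of {1, …, m}, that is, any number up to tri (suc m).
reach-xor : ∀ m v → v ≤ tri (suc m) → ∃[ b ] Reach _xor_ m (const b) (2 * v)
reach-xor zero    v v≤ rewrite n≤0⇒n≡0 v≤ = true , reach-first _xor_ (const true)
reach-xor (suc m) v v≤ with suc m ≤? v
-- The subset is chosen greedily: the largest available summand is used whenever it fits, and
-- otherwise `v ≤ m` is within reach of the remaining ones.
... | yes m<v with reach-xor m (v ∸ suc m) (m≤n+o⇒m∸n≤o v (suc m) v≤)
...   | b , r = not b , reach-≡ eq (reach-next _xor_ r (const (not b)))
  where
  xor-not : ∀ b → ⟦ b xor not b ⟧ + (⟦ b xor not b ⟧ + ⟦ not b xor not b ⟧) ≡ 2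
  xor-not true  = refl
  xor-not false = refl
  eq : rowWeight _xor_ (suc m) (const b) (const (not b)) + 2 * (v ∸ suc m) ≡ 2 * v
  eq = begin
    rowWeight _xor_ (suc m) (const b) (const (not b)) + 2 * (v ∸ suc m)
      ≡⟨ cong (_+ 2 * (v ∸ suc m)) (trans (rowWeight-const _xor_ (suc m) b (not b)) (cong (suc m *_) (xor-not b))) ⟩
    suc m * 2 + 2 * (v ∸ suc m)  ≡⟨ cong (_+ 2 * (v ∸ suc m)) (*-comm (suc m) 2) ⟩
    2 * suc m + 2 * (v ∸ suc m)  ≡⟨ *-distribˡ-+ 2 (suc m) _ ⟨
    2 * (suc m + (v ∸ suc m))    ≡⟨ cong (2 *_) (m+[n∸m]≡n m<v) ⟩
    2 * v ∎
    where open ≡-Reasoning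
reach-xor (suc m) v v≤ | no m≮v with reach-xor m v (v≤tri m (s≤s⁻¹ (≰⇒> m≮v)))
  where
  v≤tri : ∀ m → v ≤ m → v ≤ tri (suc m)
  v≤tri m v≤m = ≤-trans v≤m (m≤m+n m _)
... | b , r = b , reach-≡ eq (reach-next _xor_ r (const b))
  where
  xor-self : ∀ b → ⟦ b xor b ⟧ + (⟦ b xor b ⟧ + ⟦ b xor b ⟧) ≡ 0
  xor-self true  = refl
  xor-self false = refl
  eq : rowWeight _xor_ (suc m) (const b) (const b) + 2 * v ≡ 2 * v
  eq = cong (_+ 2 * v) (trans (rowWeight-const _xor_ (suc m) b b) (trans (cong (suc m *_) (xor-self b)) (*-zeroʳ (suc m))))

-- Half of the `12M` edges is `6M`, two edges from each of `3M` cut triangles, and `4M` triangles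
-- are available.
halfSplit-xor : ∀ m {M} → tri (suc m) ≡ 4 * M → HalfSplit _xor_ m
halfSplit-xor m {M} tri≡ with reach-xor m (3 * M) (≤-trans (*-monoˡ-≤ M (m≤n+m 3 1)) (≤-reflexive (sym tri≡)))
... | _ , reach s _ sum = s , trans (cong (2 *_) sum)
    (trans (12M M) (sym (trans (length-gridEdges m) (cong (3 *_) tri≡))))
  where
  12M : ∀ M → 2 * (2 * (3 * M)) ≡ 3 * (4 * M)
  12M = solve-∀

full empty : ℕ → Bool
full  = const true
empty = const false

prefix : ℕ → ℕ → Bool
prefix c i = i ≤ᵇ c

reach-full : ∀ m → Reach _∧_ m full (3 * tri (suc m))
reach-full zero    = reach-first _∧_ full
reach-full (suc m) = reach-≡ (trans (cong (_+ 3 * tri (suc m)) (rowWeight-const _∧_ (suc m) true true)) (3* (suc m) (tri (suc m))))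
    (reach-next _∧_ (reach-full m) full)
  where
  3* : ∀ a b → a * 3 + 3 * b ≡ 3 * (a + b)
  3* = solve-∀

rowWeight-empty : ∀ m ρ → rowWeight _∧_ m ρ empty ≡ 0
rowWeight-empty m ρ = trans (∑-cong zero-summand (downFrom m)) (trans (∑-const 0 (downFrom m)) (*-zeroʳ (length (downFrom m))))
  where
  zero-summand : ∀ i → ⟦ ρ (suc i) ∧ false ⟧ + (⟦ ρ (suc i) ∧ false ⟧ + 0) ≡ 0
  zero-summand i with ρ (suc i)
  ... | true  = refl
  ... | false = refl

reach-empty : ∀ {m ρ v} n → Reach _∧_ m ρ v → Reach _∧_ (suc (n + m)) empty v
reach-empty {m} {ρ} {v} zero r = reach-≡ (cong (_+ v) (rowWeight-empty (suc m) ρ)) (reach-next _∧_ r empty)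
reach-empty {m} {v = v} (suc n) r =
  reach-≡ (cong (_+ v) (rowWeight-empty (suc (suc (n + m))) empty)) (reach-next _∧_ (reach-empty n r) empty)

-- Below a full row, the first new vertex has one edge upwards; each of the `c` others has two
-- upwards and one to its left neighbour.
rowWeight-full-prefix : ∀ {m c} → suc c ≤ m → rowWeight _∧_ m full (prefix (suc c)) ≡ 3 * c + 1
rowWeight-full-prefix {m} {c} c<m = begin
  rowWeight _∧_ m full (prefix (suc c))
    ≡⟨ ∑-cong summand (downFrom m) ⟩
  ∑ (λ i → ⟦ i <ᵇ suc c ⟧ + 2 * ⟦ i <ᵇ c ⟧) (downFrom m)
    ≡⟨ ∑-+ (λ i → ⟦ i <ᵇ suc c ⟧) _ (downFrom m) ⟩
  ∑ (λ i → ⟦ i <ᵇ suc c ⟧) (downFrom m) + ∑ (λ i → 2 * ⟦ i <ᵇ c ⟧) (downFrom m)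
    ≡⟨ cong₂ _+_ (∑-below c<m) (trans (∑-*ˡ 2 _ (downFrom m)) (cong (2 *_) (∑-below (<⇒≤ c<m)))) ⟩
  suc c + 2 * c
    ≡⟨ rearrange c ⟩
  3 * c + 1 ∎
  where
  open ≡-Reasoning
  rearrange : ∀ c → suc c + 2 * c ≡ 3 * c + 1
  rearrange = solve-∀
  suc-<ᵇ : ∀ i c → (i <ᵇ suc c) ∧ (i <ᵇ c) ≡ (i <ᵇ c)
  suc-<ᵇ zero    zero    = refl
  suc-<ᵇ zero    (suc c) = refl
  suc-<ᵇ (suc i) zero    = ∧-zeroʳ (i <ᵇ 0)
  suc-<ᵇ (suc i) (suc c) = suc-<ᵇ i c
  summand : ∀ i → ⟦ i <ᵇ suc c ⟧ + (⟦ i <ᵇ c ⟧ + ⟦ (i <ᵇ suc c) ∧ (i <ᵇ c) ⟧) ≡ ⟦ i <ᵇ suc c ⟧ + 2 * ⟦ i <ᵇ c ⟧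
  summand i rewrite suc-<ᵇ i c | +-identityʳ ⟦ i <ᵇ c ⟧ = refl

-- Below an empty row only bases count. Three consecutive vertices span two of them, and `2 ≤ m`
-- gives the new row its three vertices.
rowWeight-empty-prefix : ∀ {m} → 2 ≤ m → rowWeight _∧_ m empty (prefix 3) ≡ 2
rowWeight-empty-prefix {m} 2≤m = trans (∑-cong {g = λ i → ⟦ i <ᵇ 2 ⟧} summand (downFrom m)) (∑-below 2≤m)
  where
  summand : ∀ i → ⟦ (i <ᵇ 3) ∧ (i <ᵇ 2) ⟧ ≡ ⟦ i <ᵇ 2 ⟧
  summand zero          = refl
  summand (suc zero)    = refl
  summand (suc (suc i)) with i <ᵇ 1
  ... | true = refl
  ... | false = refl

tri-decompose : ∀ v → ∃[ r ] ∃[ c ] (c ≤ r × v ≡ tri (suc r) + c)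
tri-decompose zero    = 0 , 0 , z≤n , refl
tri-decompose (suc v) with tri-decompose v
... | r , c , c≤r , eq with c ≟ r
...   | yes refl = suc r , 0 , z≤n , trans (cong suc eq) (rearrange r (tri (suc r)))
  where
  rearrange : ∀ r t → suc (t + r) ≡ suc r + t + 0
  rearrange = solve-∀
...   | no c≢r   = r , suc c , ≤∧≢⇒< c≤r c≢r , trans (cong suc eq) (sym (+-suc (tri (suc r)) c))

-- Below the `suc r` full rows there must be room for the partial row, an empty row and the last
-- row. Were `m ≤ 2 + r`, then `2 * tri (m - 1) ≤ tri (m + 1)`. At `m = 7` this reads 30 ≤ 28 and it
-- stays false from there on, while at `m = 6` it still holds.
partial-row-fits : ∀ m {M r c} → tri (suc m) ≡ 4 * M → m ≡ 0 ⊎ 7 ≤ m → 2 * M ≡ tri (suc r) + suc c → 3 + r ≤ m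
partial-row-fits m {M} {r} {c} tri≡ (inj₁ refl) 2M≡ rewrite *-cancelˡ-≡ M 0 4 (sym tri≡) =
  contradiction (trans 2M≡ (+-suc (tri (suc r)) c)) λ ()
partial-row-fits m {M} {r} {c} tri≡ (inj₂ 7≤m) 2M≡ with m≤n⇒∃[o]m+o≡n 7≤m
... | x , refl = ≮⇒≥ λ m≤2+r → too-large x (begin
    2 * tri (6 + x)                ≤⟨ *-monoʳ-≤ 2 (tri-mono (s≤s⁻¹ (s≤s⁻¹ m≤2+r))) ⟩
    2 * tri (suc r)                ≤⟨ *-monoʳ-≤ 2 (m≤m+n (tri (suc r)) (suc c)) ⟩
    2 * (tri (suc r) + suc c)      ≡⟨ cong (2 *_) 2M≡ ⟨
    2 * (2 * M)                    ≡⟨ *-assoc 2 2 M ⟨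
    4 * M                          ≡⟨ tri≡ ⟨
    tri (8 + x)                    ∎)
  where
  open ≤-Reasoning
  too-large : ∀ x → ¬ 2 * tri (6 + x) ≤ tri (8 + x)
  too-large x le = <-irrefl refl (begin-strict
    13 + 2 * x                        <⟨ +-monoˡ-≤ (2 * x) (n≤1+n 14) ⟩
    15 + 2 * x                        ≤⟨ +-mono-≤ (m≤m+n 15 (tri x)) (*-monoˡ-≤ x (m≤n+m 2 4)) ⟩
    15 + tri x + 6 * x                ≡⟨ tri-+ 6 x ⟨
    tri (6 + x)                       ≤⟨ +-cancelʳ-≤ (tri (6 + x)) _ _ (≤-trans (≤-reflexive (cong (tri (6 + x) +_) (sym (+-identityʳ _))))
                                           (≤-trans le (≤-reflexive (rearrange x (tri (6 + x)))))) ⟩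
    13 + 2 * x                        ∎)
    where
    rearrange : ∀ x t → 7 + x + (6 + x + t) ≡ 13 + 2 * x + t
    rearrange = solve-∀

-- The first suc r rows contribute 3 tri (suc r) edges and c further vertices at the start of the next
-- row 3c − 2; the missing two edges are a path on three vertices in the last row.
halfSplit-∧ : ∀ m {M} → tri (suc m) ≡ 4 * M → m ≡ 0 ⊎ 7 ≤ m → HalfSplit _∧_ m
halfSplit-∧ m {M} tri≡ range with tri-decompose (2 * M)
... | r , zero , _ , 2M≡ = finish (m≤n⇒∃[o]m+o≡n r≤m)
  where
  r≤m : r ≤ m
  r≤m = ≮⇒≥ λ m<r → <-irrefl refl (begin-strict
    2 * M               ≤⟨ *-monoˡ-≤ M (m≤n+m 2 2) ⟩
    4 * M               ≡⟨ tri≡ ⟨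
    tri (suc m)         <⟨ m<n+m (tri (suc m)) {suc m} z<s ⟩
    suc m + tri (suc m) ≤⟨ tri-mono (s≤s m<r) ⟩
    tri (suc r)         ≡⟨ trans 2M≡ (+-identityʳ _) ⟨
    2 * M               ∎)
    where open ≤-Reasoning

  total≡ : ∀ {ρ} → Reach _∧_ m ρ (3 * tri (suc r)) → HalfSplit _∧_ m
  total≡ (reach s _ sum) = s , (begin
    2 * ∑ (weight _∧_ s) (gridEdges m) ≡⟨ cong (2 *_) sum ⟩
    2 * (3 * tri (suc r))              ≡⟨ cong (λ x → 2 * (3 * x)) (trans 2M≡ (+-identityʳ _)) ⟨
    2 * (3 * (2 * M))                  ≡⟨ 12M M ⟩
    3 * (4 * M)                        ≡⟨ cong (3 *_) tri≡ ⟨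
    3 * tri (suc m)                    ≡⟨ length-gridEdges m ⟨
    length (gridEdges m)               ∎)
    where
    open ≡-Reasoning
    12M : ∀ M → 2 * (3 * (2 * M)) ≡ 3 * (4 * M)
    12M = solve-∀

  finish : (∃[ o ] r + o ≡ m) → HalfSplit _∧_ m
  finish (zero  , eq) = total≡ (subst (λ k → Reach _∧_ k full _) (trans (sym (+-identityʳ r)) eq) (reach-full r))
  finish (suc o , eq) =
    total≡ (subst (λ k → Reach _∧_ k empty _) (trans (trans (cong suc (+-comm o r)) (sym (+-suc r o))) eq) (reach-empty o (reach-full r)))
... | r , suc c , c<r , 2M≡ = finish (m≤n⇒∃[o]m+o≡n (partial-row-fits m {M} {r} {c} tri≡ range 2M≡))
  where
  total : ℕ
  total = 2 + (3 * c + 1 + 3 * tri (suc r))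

  index : ∀ r o → 2 + (o + suc r) ≡ 3 + r + o
  index = solve-∀

  total≡ : ∀ {ρ} → Reach _∧_ m ρ total → HalfSplit _∧_ m
  total≡ (reach s _ sum) = s , (begin
    2 * ∑ (weight _∧_ s) (gridEdges m) ≡⟨ cong (2 *_) sum ⟩
    2 * total                          ≡⟨ rearrange c (tri (suc r)) ⟩
    6 * (tri (suc r) + suc c)          ≡⟨ cong (6 *_) 2M≡ ⟨
    6 * (2 * M)                        ≡⟨ 12M M ⟩
    3 * (4 * M)                        ≡⟨ cong (3 *_) tri≡ ⟨
    3 * tri (suc m)                    ≡⟨ length-gridEdges m ⟨
    length (gridEdges m)               ∎)
    where
    open ≡-Reasoning
    rearrange : ∀ c t → 2 * (2 + (3 * c + 1 + 3 * t)) ≡ 6 * (t + suc c)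
    rearrange = solve-∀
    12M : ∀ M → 6 * (2 * M) ≡ 3 * (4 * M)
    12M = solve-∀

  row-total : ∀ o → rowWeight _∧_ (2 + (o + suc r)) empty (prefix 3)
                    + (rowWeight _∧_ (suc r) full (prefix (suc c)) + 3 * tri (suc r)) ≡ total
  row-total o = cong₂ (λ x y → x + (y + 3 * tri (suc r)))
    (rowWeight-empty-prefix {2 + (o + suc r)} (s≤s (s≤s z≤n)))
    (rowWeight-full-prefix (≤-trans c<r (n≤1+n r)))

  finish : (∃[ o ] 3 + r + o ≡ m) → HalfSplit _∧_ m
  -- At least one empty row separates the path from the partial row, so that no edge between them is
  -- added.
  finish (o , eq) = total≡ (subst (λ k → Reach _∧_ k (prefix 3) total) (trans (index r o) eq)
    (reach-≡ (row-total o)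
      (reach-next _∧_ (reach-empty o (reach-next _∧_ (reach-full r) (prefix (suc c)))) (prefix 3))))

-- `tri` has period 8 modulo 4: `tri 8 = 28` and all cross terms are multiples of 8.
tri-mod : ∀ r k → ∃[ M ] tri (r + k * 8) ≡ tri r + 4 * M
tri-mod r k with tri[8k] k
  where
  tri[8k] : ∀ k → ∃[ M ] tri (k * 8) ≡ 4 * M
  tri[8k] zero    = 0 , refl
  tri[8k] (suc k) with tri[8k] k
  ... | M , eq = 7 + M + 16 * k , trans (tri-+ 8 (k * 8)) (trans (cong (λ x → 28 + x + 8 * (k * 8)) eq) (rearrange M k))
    where
    rearrange : ∀ M k → 28 + 4 * M + 8 * (k * 8) ≡ 4 * (7 + M + 16 * k)
    rearrange = solve-∀
... | M , eq = M + 2 * (r * k) , trans (tri-+ r (k * 8)) (trans (cong (λ x → tri r + x + r * (k * 8)) eq) (rearrange (tri r) M r k))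
  where
  rearrange : ∀ t M r k → t + 4 * M + r * (k * 8) ≡ t + 4 * (M + 2 * (r * k))
  rearrange = solve-∀

tri-% : ∀ h → ∃[ M ] tri h ≡ tri (h % 8) + 4 * M
tri-% h with tri-mod (h % 8) (h / 8)
... | M , eq = M , trans (cong tri (m≡m%n+[m/n]*n h 8)) eq

-- Copies of the grid in a complete graph

module _ {n : ℕ} where

  joins-sym : ∀ {e : Edge n} {x y} → Joins e x y → Joins e y x
  joins-sym (inj₁ eq) = inj₂ eq
  joins-sym (inj₂ eq) = inj₁ eq

  edge-between : ∀ {x y : Fin n} → x ≢ y → ∃[ e ] Joins e x y
  edge-between {x} {y} x≢y with Finₚ.<-cmp x y
  ... | tri< x<y _ _ = ((x , y) , x<y) , inj₁ (refl , refl)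
  ... | tri≈ _ x≡y _ = contradiction x≡y x≢y
  ... | tri> _ _ y<x = ((y , x) , y<x) , inj₂ (refl , refl)

  joins-irrefl : ∀ {e : Edge n} {x y} → Joins e x y → x ≢ y
  joins-irrefl {_ , lo<hi} (inj₁ (refl , refl)) refl = Finₚ.<-irrefl refl lo<hi
  joins-irrefl {_ , lo<hi} (inj₂ (refl , refl)) refl = Finₚ.<-irrefl refl lo<hi

  joins-unique : ∀ {e e′ : Edge n} {x y} → Joins e x y → Joins e′ x y → e ≡ e′
  joins-unique {_ , p} {_ , q} (inj₁ (refl , refl)) (inj₁ (refl , refl)) = cong (_ ,_) (Finₚ.<-irrelevant p q)
  joins-unique {_ , p} {_ , q} (inj₁ (refl , refl)) (inj₂ (refl , refl)) = contradiction q (Finₚ.<-asym p)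
  joins-unique {_ , p} {_ , q} (inj₂ (refl , refl)) (inj₁ (refl , refl)) = contradiction q (Finₚ.<-asym p)
  joins-unique {_ , p} {_ , q} (inj₂ (refl , refl)) (inj₂ (refl , refl)) = cong (_ ,_) (Finₚ.<-irrelevant p q)

  joins-endpoints : ∀ {e : Edge n} {x y x′ y′} → Joins e x y → Joins e x′ y′ →
                    (x ≡ x′ × y ≡ y′) ⊎ (x ≡ y′ × y ≡ x′)
  joins-endpoints (inj₁ (refl , refl)) (inj₁ eqs)       = inj₁ eqs
  joins-endpoints (inj₁ (refl , refl)) (inj₂ eqs)       = inj₂ eqs
  joins-endpoints (inj₂ (refl , refl)) (inj₁ (eq , eq′)) = inj₂ (eq′ , eq)
  joins-endpoints (inj₂ (refl , refl)) (inj₂ (eq , eq′)) = inj₁ (eq′ , eq)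

step-asym : ∀ {p q} → Step p q → ¬ Step q p
step-asym horizontal ()
step-asym downLeft   ()
step-asym downRight  ()

module _ {A B : Set} {R : A → B → Set} where

  pointwise-∈ˡ : ∀ {xs ys x} → Pointwise R xs ys → x ∈ xs → ∃[ y ] y ∈ ys × R x y
  pointwise-∈ˡ (r ∷ _)  (here refl) = _ , here refl , r
  pointwise-∈ˡ (_ ∷ rs) (there x∈) with pointwise-∈ˡ rs x∈
  ... | y , y∈ , r = y , there y∈ , r

  pointwise-∈ʳ : ∀ {xs ys y} → Pointwise R xs ys → y ∈ ys → ∃[ x ] x ∈ xs × R x y
  pointwise-∈ʳ (r ∷ _)  (here refl) = _ , here refl , r
  pointwise-∈ʳ (_ ∷ rs) (there y∈) with pointwise-∈ʳ rs y∈
  ... | x , x∈ , r = x , there x∈ , r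

  pointwise-unique : ∀ {xs ys} → Pointwise R xs ys →
                     (∀ {x y y′} → y ∈ ys → y′ ∈ ys → R x y → R x y′ → y ≡ y′) →
                     Unique ys → Unique xs
  pointwise-unique []       _   []          = []
  pointwise-unique (r ∷ rs) fun (y∉ys ∷ ys!) =
    All.tabulate (λ { x∈ refl → let (_ , y∈ , r′) = pointwise-∈ˡ rs x∈ in
                                All.lookup y∉ys y∈ (fun (here refl) (there y∈) r r′) })
    ∷ pointwise-unique rs (λ y∈ y′∈ → fun (there y∈) (there y′∈)) ys!

  ∑-pointwise : ∀ {f g xs ys} → Pointwise R xs ys →
                (∀ {x y} → y ∈ ys → R x y → f x ≡ g y) → ∑ f xs ≡ ∑ g ys
  ∑-pointwise []       eq = refl
  ∑-pointwise (r ∷ rs) eq = cong₂ _+_ (eq (here refl) r) (∑-pointwise rs (eq ∘ there))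

-- This serves both directions: building a copy from a placement of the vertices, and reading off
-- the edges of a given copy. As `Point` also contains pairs outside the grid, injectivity is asked
-- on the grid only.
module Realise {n m} (φ : Point → Fin n)
               (φ-injective : ∀ {p q} → InGrid (suc m) p → InGrid (suc m) q → φ p ≡ φ q → p ≡ q) where

  Represents : Edge n → Point × Point → Set
  Represents e (p , q) = Joins e (φ p) (φ q)

  represent : ∀ gs → (∀ {p q} → (p , q) ∈ gs → φ p ≢ φ q) → ∃[ es ] Pointwise Represents es gs
  represent []             _ = [] , []
  represent ((p , q) ∷ gs) distinct =
    let e  , r  = edge-between (distinct (here refl))
        es , rs = represent gs (distinct ∘ there)
    in e ∷ es , r ∷ rs

  private
    represented : ∃[ es ] Pointwise Represents es (gridEdges m)
    represented = represent (gridEdges m) λ pq∈ φp≡φq →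
      let p∈ , q∈ , step = ∈-gridEdges⁻ m pq∈ in step-irrefl (φ-injective p∈ q∈ φp≡φq) step

  image : List (Edge n)
  image = proj₁ represented

  image-represents : Pointwise Represents image (gridEdges m)
  image-represents = proj₂ represented

  represents-injective : ∀ {e g g′} → g ∈ gridEdges m → g′ ∈ gridEdges m →
                         Represents e g → Represents e g′ → g ≡ g′
  represents-injective {e} g∈ g′∈ r r′ with ∈-gridEdges⁻ m g∈ | ∈-gridEdges⁻ m g′∈ | joins-endpoints {e = e} r r′
  ... | p∈ , q∈ , _ | p′∈ , q′∈ , _ | inj₁ (eq , eq′) = cong₂ _,_ (φ-injective p∈ p′∈ eq) (φ-injective q∈ q′∈ eq′)
  -- If the endpoints matched crosswise, the same two points would form a step in both directions.
  ... | p∈ , q∈ , step | p′∈ , q′∈ , step′ | inj₂ (eq , eq′)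
    with refl ← φ-injective p∈ q′∈ eq | refl ← φ-injective q∈ p′∈ eq′ = contradiction step′ (step-asym step)

  image-unique : Unique image
  image-unique = pointwise-unique image-represents (λ {e} → represents-injective {e}) (gridEdges-unique m)

  image-adjacent⁺ : ∀ {p q} → InGrid (suc m) p → InGrid (suc m) q → SymClosure Step p q →
                    ∃[ e ] e ∈ image × Joins e (φ p) (φ q)
  image-adjacent⁺ p∈ q∈ (fwd step) = pointwise-∈ʳ image-represents (∈-gridEdges⁺ p∈ q∈ step)
  image-adjacent⁺ p∈ q∈ (bwd step) =
    let e , e∈ , r = pointwise-∈ʳ image-represents (∈-gridEdges⁺ q∈ p∈ step)
    in e , e∈ , joins-sym {e = e} r

  image-adjacent⁻ : ∀ {p q e} → InGrid (suc m) p → InGrid (suc m) q →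
                    e ∈ image → Joins e (φ p) (φ q) → SymClosure Step p q
  image-adjacent⁻ {e = e} p∈ q∈ e∈ j with pointwise-∈ˡ image-represents e∈
  ... | _ , g∈ , r with ∈-gridEdges⁻ m g∈ | joins-endpoints {e = e} r j
  ...   | p′∈ , q′∈ , step | inj₁ (eq , eq′)
    with refl ← φ-injective p′∈ p∈ eq | refl ← φ-injective q′∈ q∈ eq′ = fwd step
  ...   | p′∈ , q′∈ , step | inj₂ (eq , eq′)
    with refl ← φ-injective p′∈ q∈ eq | refl ← φ-injective q′∈ p∈ eq′ = bwd step

opposite : Colour → Colour
opposite red  = blue
opposite blue = red

opposite-≢ : ∀ c → opposite c ≢ c
opposite-≢ red  ()
opposite-≢ blue ()

Adj : ∀ {n} → Colouring n → Colour → Fin n → Fin n → Set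
Adj α c x y = ∃[ e ] Joins e x y × α e ≡ c

module _ {n} (α : Colouring n) where

  coloured : Colour → List (Edge n) → List (Edge n)
  coloured c = filter (λ e → α e ≟ᶜ c)

  colour-classes : ∀ es → coloured red es ++ coloured blue es ↭ es
  colour-classes [] = ↭-refl
  colour-classes (e ∷ es) with α e
  ... | red  = prep e (colour-classes es)
  ... | blue = ↭-trans (shift e (coloured red es) (coloured blue es)) (prep e (colour-classes es))

  balanced-classes : ∀ c es → 2 * length (coloured c es) ≡ length es →
                     ∣ length (coloured red es) - length (coloured blue es) ∣ ≤ 1
  balanced-classes c es half = ≤-trans (≤-reflexive (m≡n⇒∣m-n∣≡0 (same-size c half))) z≤n
    where
    r+b : length (coloured red es) + length (coloured blue es) ≡ length es
    r+b = trans (sym (length-++ (coloured red es))) (↭-length (colour-classes es))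

    same-size : ∀ c → 2 * length (coloured c es) ≡ length es → length (coloured red es) ≡ length (coloured blue es)
    same-size red  half = sym (+-cancelˡ-≡ (length (coloured red es)) _ _
      (trans r+b (trans (sym half) (cong (length (coloured red es) +_) (+-identityʳ _)))))
    same-size blue half = +-cancelʳ-≡ (length (coloured blue es)) _ _
      (trans r+b (trans (sym half) (cong (length (coloured blue es) +_) (+-identityʳ _))))

  module _ {m} (φ : Point → Fin n)
           (φ-injective : ∀ {p q} → InGrid (suc m) p → InGrid (suc m) q → φ p ≡ φ q → p ≡ q) where

    open Realise {m = m} φ φ-injective

    private
      G = T (suc m)
      open Graph G
      to : Vertex → Fin n
      to (p , _) = φ p
      open DecMembership (Finₚ._≟_ {n}) using (_∈?_)

      support : Subset n
      support = Vec.tabulate λ x → does (x ∈? map to vertices)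

      ∈-support⁺ : ∀ u → to u Subset.∈ support
      ∈-support⁺ u = Vecₚ.lookup⇒[]= (to u) support
        (trans (Vecₚ.lookup∘tabulate _ (to u)) (dec-true (to u ∈? _) (∈-map⁺ to (vertices-all u))))

      ∈-support⁻ : ∀ {x} → x Subset.∈ support → ∃[ u ] to u ≡ x
      ∈-support⁻ {x} x∈ with x ∈? map to vertices | trans (sym (Vecₚ.lookup∘tabulate (λ x → does (x ∈? map to vertices)) x)) (Vecₚ.[]=⇒lookup x∈)
      ... | yes x∈image | _ = let u , _ , eq = ∈-map⁻ to x∈image in u , sym eq
      ... | no _        | ()

      subgraph : Subgraph n
      subgraph = record
        { V        = support
        ; E        = image
        ; E-unique = image-unique
        ; E⊆V      = ends∈
        }
        where
        ends∈ : ∀ {e} → e ∈ image → lo e Subset.∈ support × hi e Subset.∈ support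
        ends∈ e∈ with pointwise-∈ˡ image-represents e∈
        ... | _ , g∈ , r with ∈-gridEdges⁻ m g∈ | r
        ...   | p∈ , q∈ , _ | inj₁ (refl , refl) = ∈-support⁺ (_ , p∈) , ∈-support⁺ (_ , q∈)
        ...   | p∈ , q∈ , _ | inj₂ (refl , refl) = ∈-support⁺ (_ , q∈) , ∈-support⁺ (_ , p∈)

      isomorphic : G ≅ subgraph
      isomorphic = record
        { to         = to
        ; to-∈       = ∈-support⁺
        ; injective  = λ { {_ , p∈} {_ , q∈} eq → vertex-≡ p∈ q∈ (φ-injective p∈ q∈ eq) }
        ; surjective = ∈-support⁻
        ; adjacency  = λ { (_ , p∈) (_ , q∈) →
            mk⇔ (image-adjacent⁺ p∈ q∈) (λ (e , e∈ , j) → image-adjacent⁻ {e = e} p∈ q∈ e∈ j) }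
        }
        where
        vertex-≡ : ∀ {p q} (p∈ : InGrid (suc m) p) (q∈ : InGrid (suc m) q) → p ≡ q → (p , p∈) ≡ (q , q∈)
        vertex-≡ p∈ q∈ refl = cong (_ ,_) (inGrid-irrelevant p∈ q∈)

    -- The edges of colour `c` in the image correspond to the grid edges of weight 1, exactly half
    -- of all, so the other colour gets the other half.
    balanced-copy : ∀ β c ((s , _) : HalfSplit β m) →
                    (∀ {p q} → InGrid (suc m) p → InGrid (suc m) q → Step p q →
                       Adj α (if β (s p) (s q) then c else opposite c) (φ p) (φ q)) →
                    BalancedCopy (T (suc m)) α
    balanced-copy β c (s , half) colours = record
      { H         = subgraph
      ; G≅H       = isomorphic
      ; E₁        = coloured red image
      ; E₂        = coloured blue image
      ; partition = colour-classes image
      ; E₁-red    = all-filter _ image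
      ; E₂-blue   = all-filter _ image
      ; balanced  = balanced-classes c image (begin
          2 * length (coloured c image)                ≡⟨ cong (2 *_) (length-filter _ image) ⟩
          2 * ∑ (λ e → ⟦ does (α e ≟ᶜ c) ⟧) image       ≡⟨ cong (2 *_) (∑-pointwise image-represents (λ {e} → same-colour {e})) ⟩
          2 * ∑ (weight β s) (gridEdges m)             ≡⟨ half ⟩
          length (gridEdges m)                         ≡⟨ Pointwise.Pointwise-length image-represents ⟨
          length image                                 ∎)
      }
      where
      open ≡-Reasoning
      same-colour : ∀ {e g} → g ∈ gridEdges m → Represents e g → ⟦ does (α e ≟ᶜ c) ⟧ ≡ weight β s g
      same-colour {e} {p , q} g∈ r with ∈-gridEdges⁻ m g∈
      ... | p∈ , q∈ , step with colours p∈ q∈ step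
      ...   | e′ , j , eq rewrite joins-unique {e = e} {e′} r j | eq with β (s p) (s q)
      ...     | true  rewrite dec-true (c ≟ᶜ c) refl = refl
      ...     | false rewrite dec-false (opposite c ≟ᶜ c) (opposite-≢ c) = refl

module _ {n m} {H : Subgraph n} (iso : T (suc m) ≅ H) where

  open _≅_ iso
  open Subgraph H

  private
    φ : Point → Fin n
    φ p with inGrid? (suc m) p
    ... | yes p∈ = to (p , p∈)
    -- A default off the grid: the top corner exists in every `T (suc m)`.
    ... | no _   = to ((1 , 1) , s≤s z≤n , s≤s z≤n , s≤s z≤n)

    φ≡to : ∀ {p} (p∈ : InGrid (suc m) p) → φ p ≡ to (p , p∈)
    φ≡to {p} p∈ with inGrid? (suc m) p
    ... | yes p∈′ = cong (λ x → to (p , x)) (inGrid-irrelevant p∈′ p∈)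
    ... | no  p∉  = contradiction p∈ p∉

    φ-injective : ∀ {p q} → InGrid (suc m) p → InGrid (suc m) q → φ p ≡ φ q → p ≡ q
    φ-injective p∈ q∈ eq = cong proj₁ (injective (trans (sym (φ≡to p∈)) (trans eq (φ≡to q∈))))

    open Realise {m = m} φ φ-injective

    E⊆image : ∀ {e} → e ∈ E → e ∈ image
    E⊆image {e} e∈ with E⊆V e∈
    ... | lo∈ , hi∈ with surjective lo∈ | surjective hi∈
    ...   | (p , p∈) , eq | (q , q∈) , eq′
      with image-adjacent⁺ p∈ q∈ (Equivalence.from (adjacency (p , p∈) (q , q∈)) (e , e∈ , inj₁ (sym eq , sym eq′)))
    ...     | e′ , e′∈ , j = subst (_∈ image)
              (joins-unique {e = e′} {e} j (inj₁ (trans (sym eq) (sym (φ≡to p∈)) , trans (sym eq′) (sym (φ≡to q∈))))) e′∈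

    image⊆E : ∀ {e} → e ∈ image → e ∈ E
    image⊆E {e} e∈ with pointwise-∈ˡ image-represents e∈
    ... | (p , q) , g∈ , r with ∈-gridEdges⁻ m g∈
    ...   | p∈ , q∈ , step with Equivalence.to (adjacency (p , p∈) (q , q∈)) (fwd step)
    ...     | e′ , e′∈ , j = subst (_∈ E)
              (joins-unique {e = e′} {e} j (subst₂ (Joins e) (φ≡to p∈) (φ≡to q∈) r)) e′∈

  -- Duplicate-free lists with the same members are permutations of each other. Hence the edges of
  -- any copy can be counted along `gridEdges`, in whatever order the subgraph lists them.
  edges-of-copy : ∃[ ψ ] ∃[ es ] E ↭ es × Pointwise (λ e (p , q) → Joins e (ψ p) (ψ q)) es (gridEdges m)
  edges-of-copy = φ , image , ∼bag⇒↭ (unique∧set⇒bag E-unique image-unique (mk⇔ E⊆image image⊆E)) , image-represents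

-- Cut colourings

∑-edges : ∀ n (f : Edge n → ℕ) →
          ∑ f (edges n) ≡ ∑ (λ x → ∑ (λ y → selected (uncurry Fin._<?_) f (x , y)) (allFin n)) (allFin n)
∑-edges n f = trans (∑-select (uncurry Fin._<?_) f (cartesianProduct (allFin n) (allFin n)))
                    (∑-cartesianProduct _ (allFin n) (allFin n))

length-edges : ∀ n → length (edges n) ≡ tri n
length-edges n = begin
  length (edges n)
    ≡⟨ ∑-const-1 (edges n) ⟨
  ∑ (const 1) (edges n)
    ≡⟨ ∑-edges n (const 1) ⟩
  ∑ (λ x → ∑ (λ y → selected (uncurry Fin._<?_) (const 1) (x , y)) (allFin n)) (allFin n)
    ≡⟨ ∑-cong (λ x → ∑-cong (λ y → indicator x y) (allFin n)) (allFin n) ⟩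
  ∑ (λ x → ∑ (λ y → ⟦ toℕ x <ᵇ toℕ y ⟧) (allFin n)) (allFin n)
    ≡⟨ ∑-swap (λ x y → ⟦ toℕ x <ᵇ toℕ y ⟧) (allFin n) (allFin n) ⟩
  ∑ (λ y → ∑ (λ x → ⟦ toℕ x <ᵇ toℕ y ⟧) (allFin n)) (allFin n)
    ≡⟨ ∑-cong (λ y → trans (∑-allFin (λ i → ⟦ i <ᵇ toℕ y ⟧) n) (∑-below (<⇒≤ (Finₚ.toℕ<n y)))) (allFin n) ⟩
  ∑ toℕ (allFin n)
    ≡⟨ ∑-allFin id n ⟩
  tri n ∎
  where
  open ≡-Reasoning
  indicator : ∀ (x y : Fin n) → selected (uncurry Fin._<?_) (const 1) (x , y) ≡ ⟦ toℕ x <ᵇ toℕ y ⟧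
  indicator x y with x Fin.<? y | toℕ x <? toℕ y
  ... | yes x<y | yes _ rewrite dec-true  (toℕ x <? toℕ y) x<y = refl
  ... | no  x≮y | no _ rewrite dec-false (toℕ x <? toℕ y) x≮y = refl
  ... | yes x<y | no x≮y = contradiction x<y x≮y
  ... | no  x≮y | yes x<y = contradiction x<y x≮y

module _ {n : ℕ} (a : ℕ) where

  below : Fin n → Bool
  below x = toℕ x <ᵇ a

  cutColouring : Colouring n
  cutColouring e = if below (lo e) xor below (hi e) then red else blue

  -- One side is an initial segment and edges have their smaller endpoint first, so an edge is cut
  -- exactly when its first endpoint is below `a` and its second is not. That condition already
  -- forces the first to be smaller, so the double sum over all pairs factors.
  count-cut : a ≤ n → count cutColouring red ≡ a * (n ∸ a)
  count-cut a≤n = begin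
    count cutColouring red
      ≡⟨ length-filter _ (edges n) ⟩
    ∑ isRed (edges n)
      ≡⟨ ∑-edges n isRed ⟩
    ∑ (λ x → ∑ (λ y → selected (uncurry Fin._<?_) isRed (x , y)) (allFin n)) (allFin n)
      ≡⟨ ∑-cong (λ x → ∑-cong (λ y → product x y) (allFin n)) (allFin n) ⟩
    ∑ (λ x → ∑ (λ y → ⟦ below x ⟧ * ⟦ not (below y) ⟧) (allFin n)) (allFin n)
      ≡⟨ ∑-cong (λ x → trans (∑-*ˡ ⟦ below x ⟧ _ (allFin n)) (*-comm ⟦ below x ⟧ _)) (allFin n) ⟩
    ∑ (λ x → above * ⟦ below x ⟧) (allFin n)
      ≡⟨ ∑-*ˡ above _ (allFin n) ⟩
    above * ∑ (λ x → ⟦ below x ⟧) (allFin n)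
      ≡⟨ cong₂ _*_ above≡ below≡ ⟩
    (n ∸ a) * a
      ≡⟨ *-comm (n ∸ a) a ⟩
    a * (n ∸ a) ∎
    where
    open ≡-Reasoning
    isRed : Edge n → ℕ
    isRed e = ⟦ does (cutColouring e ≟ᶜ red) ⟧

    above : ℕ
    above = ∑ (λ y → ⟦ not (below y) ⟧) (allFin n)

    below≡ : ∑ (λ x → ⟦ below x ⟧) (allFin n) ≡ a
    below≡ = trans (∑-allFin (λ i → ⟦ i <ᵇ a ⟧) n) (∑-below a≤n)

    above≡ : above ≡ n ∸ a
    above≡ = begin
      above            ≡⟨ m+n∸m≡n a above ⟨
      a + above ∸ a    ≡⟨ cong (λ x → x + above ∸ a) below≡ ⟨
      ∑ (λ x → ⟦ below x ⟧) (allFin n) + above ∸ a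
        ≡⟨ cong (_∸ a) (trans (sym (∑-+ (λ x → ⟦ below x ⟧) _ (allFin n)))
             (trans (∑-cong (λ x → ⟦not⟧ (below x)) (allFin n)) (trans (∑-const-1 (allFin n)) (length-tabulate id)))) ⟩
      n ∸ a ∎

    product : ∀ x y → selected (uncurry Fin._<?_) isRed (x , y) ≡ ⟦ below x ⟧ * ⟦ not (below y) ⟧
    product x y with x Fin.<? y
    ... | yes x<y with toℕ x <? a | toℕ y <? a
    ...   | yes x<a | yes y<a rewrite dec-true (toℕ x <? a) x<a | dec-true (toℕ y <? a) y<a = refl
    ...   | yes x<a | no  y≮a rewrite dec-true (toℕ x <? a) x<a | dec-false (toℕ y <? a) y≮a = refl
    ...   | no  x≮a | no  y≮a rewrite dec-false (toℕ x <? a) x≮a | dec-false (toℕ y <? a) y≮a = refl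
    ...   | no  x≮a | yes y<a = contradiction (<-trans x<y y<a) x≮a
    product x y | no x≮y with toℕ x <? a | toℕ y <? a
    ...   | yes x<a | yes y<a rewrite dec-true (toℕ x <? a) x<a | dec-true (toℕ y <? a) y<a = refl
    ...   | no  x≮a | _       rewrite dec-false (toℕ x <? a) x≮a = refl
    ...   | yes x<a | no  y≮a = contradiction (<-≤-trans x<a (≮⇒≥ y≮a)) x≮y

  even-copy : ∀ {m} (c : BalancedCopy (T (suc m)) cutColouring) →
              ∃[ x ] length (BalancedCopy.E₁ c) ≡ 2 * x
  even-copy {m} copy with edges-of-copy (BalancedCopy.G≅H copy)
  ... | ψ , es , E↭es , rep = ∑ mixed (triangles m) , (begin
      length E₁                                    ≡⟨ cong length (sym red-class) ⟩
      length (coloured cutColouring red (E₁ ++ E₂)) ≡⟨ ↭-length (filter-↭ _ (↭-trans partition E↭es)) ⟩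
      length (coloured cutColouring red es)        ≡⟨ length-filter _ es ⟩
      ∑ (λ e → ⟦ does (cutColouring e ≟ᶜ red) ⟧) es ≡⟨ ∑-pointwise rep (λ {e} _ → same-weight {e}) ⟩
      ∑ (weight _xor_ s) (gridEdges m)             ≡⟨ ∑-gridEdges (weight _xor_ s) m ⟩
      ∑ _ (triangles m)                            ≡⟨ ∑-cong (λ t → two (s t) (s (proj₂ (left t))) (s (proj₂ (right t)))) (triangles m) ⟩
      ∑ (λ t → 2 * mixed t) (triangles m)          ≡⟨ ∑-*ˡ 2 mixed (triangles m) ⟩
      2 * ∑ mixed (triangles m)                    ∎)
    where
    open BalancedCopy copy
    open ≡-Reasoning
    s : Point → Bool
    s p = below (ψ p)

    -- The triangle is cut exactly when its top is separated from one of the other two corners; then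
    -- two of its edges are cut.
    mixed : Point → ℕ
    mixed t = ⟦ (s t xor s (proj₂ (left t))) ∨ (s t xor s (proj₂ (right t))) ⟧

    two : ∀ a b c → ⟦ a xor b ⟧ + (⟦ a xor c ⟧ + ⟦ b xor c ⟧) ≡ 2 * ⟦ (a xor b) ∨ (a xor c) ⟧
    two true  true  true  = refl
    two true  true  false = refl
    two true  false true  = refl
    two true  false false = refl
    two false true  true  = refl
    two false true  false = refl
    two false false true  = refl
    two false false false = refl

    red-class : coloured cutColouring red (E₁ ++ E₂) ≡ E₁
    red-class = trans (filter-++ _ E₁ E₂) (trans (cong₂ _++_ (filter-all _ E₁-red)
      (filter-none _ (All.map (λ { eq eq′ → contradiction (trans (sym eq) eq′) λ () }) E₂-blue))) (++-identityʳ E₁))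

    colour-bit : ∀ b → ⟦ does ((if b then red else blue) ≟ᶜ red) ⟧ ≡ ⟦ b ⟧
    colour-bit true  = refl
    colour-bit false = refl

    same-weight : ∀ {e p q} → Joins e (ψ p) (ψ q) → ⟦ does (cutColouring e ≟ᶜ red) ⟧ ≡ weight _xor_ s (p , q)
    same-weight {e} (inj₁ (eq , eq′)) = trans (colour-bit (below (lo e) xor below (hi e)))
      (cong₂ (λ x y → ⟦ below x xor below y ⟧) eq eq′)
    same-weight {e} (inj₂ (eq , eq′)) = trans (colour-bit (below (lo e) xor below (hi e)))
      (trans (cong ⟦_⟧ (xor-comm (below (lo e)) (below (hi e)))) (cong₂ (λ x y → ⟦ below x xor below y ⟧) eq′ eq))

-- One part and the total are even, hence so is the other part. The difference of the parts is then
-- even and at most 1, so it vanishes.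
balanced-halves : ∀ x b K → 2 * x + b ≡ 2 * K → ∣ 2 * x - b ∣ ≤ 1 → 2 * x ≡ K
balanced-halves x b K total balanced = begin
  2 * x         ≡⟨ cong (x +_) (+-identityʳ x) ⟩
  x + x         ≡⟨ cong (x +_) x≡y ⟩
  x + y         ≡⟨ *-cancelˡ-≡ (x + y) K 2 (trans (*-distribˡ-+ 2 x y) (trans (cong (2 * x +_) (sym b≡)) total)) ⟩
  K             ∎
  where
  open ≡-Reasoning
  y = K ∸ x

  b≡ : b ≡ 2 * y
  b≡ = begin
    b                   ≡⟨ m+n∸m≡n (2 * x) b ⟨
    2 * x + b ∸ 2 * x   ≡⟨ cong (_∸ 2 * x) total ⟩
    2 * K ∸ 2 * x       ≡⟨ *-distribˡ-∸ 2 K x ⟨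
    2 * y               ∎

  x≡y : x ≡ y
  x≡y = ∣m-n∣≡0⇒m≡n (n<1⇒n≡0 (*-cancelˡ-< 2 ∣ x - y ∣ 1 (s≤s (≤-trans
    (≤-reflexive (trans (*-distribˡ-∣-∣ 2 x y) (cong ∣ 2 * x -_∣ (sym b≡)))) balanced))))

no-balanced-copy : ∀ {m M n} a → tri (suc m) ≡ 2 + 4 * M → ¬ BalancedCopy (T (suc m)) (cutColouring {n} a)
no-balanced-copy {m} {M} {n} a tri≡ copy =
  let x , E₁≡ = even-copy a copy
      _ , _ , E↭es , rep = edges-of-copy G≅H
  in even≢odd x (3 * M + 1) (trans
       (balanced-halves x (length E₂) K (trans (cong (_+ length E₂) (sym E₁≡)) (size E↭es rep))
         (subst (λ k → ∣ k - length E₂ ∣ ≤ 1) E₁≡ balanced))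
       (odd M))
  where
  open BalancedCopy copy
  open ≡-Reasoning
  K : ℕ
  K = 3 * (1 + 2 * M)

  odd : ∀ M → 3 * (1 + 2 * M) ≡ suc (2 * (3 * M + 1))
  odd = solve-∀

  double : ∀ M → 3 * (2 + 4 * M) ≡ 2 * (3 * (1 + 2 * M))
  double = solve-∀

  size : ∀ {es} {R : Edge n → Point × Point → Set} → Subgraph.E H ↭ es → Pointwise R es (gridEdges m) → length E₁ + length E₂ ≡ 2 * K
  size {es} E↭es rep = begin
    length E₁ + length E₂     ≡⟨ length-++ E₁ ⟨
    length (E₁ ++ E₂)         ≡⟨ ↭-length (↭-trans partition E↭es) ⟩
    length es                 ≡⟨ Pointwise.Pointwise-length rep ⟩
    length (gridEdges m)      ≡⟨ length-gridEdges m ⟩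
    3 * tri (suc m)           ≡⟨ cong (3 *_) tri≡ ⟩
    3 * (2 + 4 * M)           ≡⟨ double M ⟩
    2 * K                     ∎

-- n = k² makes the halving equation 2a(n − a) = n(n − 1)/2 solvable, with a = k(k − 1)/2.
square-halving : ∀ k → let a = tri k; b = tri (suc k) in tri a + tri b ≡ a * b
-- Here `k * k` is both `a + b` and `(b - a)²`. Adding it to the doubled sides turns each into
-- `a * a + b * b`.
square-halving k = *-cancelˡ-≡ _ _ 2 (+-cancelʳ-≡ (k * k) _ _ (begin
    2 * (tri a + tri b) + k * k
      ≡⟨ cong (2 * (tri a + tri b) +_) (trans (sym (2*tri+n≡n² k)) (k+2a k a)) ⟩
    2 * (tri a + tri b) + (a + b)
      ≡⟨ split (tri a) (tri b) a b ⟩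
    (2 * tri a + a) + (2 * tri b + b)
      ≡⟨ cong₂ _+_ (2*tri+n≡n² a) (2*tri+n≡n² b) ⟩
    a * a + b * b
      ≡⟨ squares k a ⟩
    2 * (a * b) + k * k ∎))
  where
  open ≡-Reasoning
  a = tri k
  b = tri (suc k)
  k+2a : ∀ k a → 2 * a + k ≡ a + (k + a)
  k+2a = solve-∀
  split : ∀ s t a b → 2 * (s + t) + (a + b) ≡ (2 * s + a) + (2 * t + b)
  split = solve-∀
  squares : ∀ k a → a * a + (k + a) * (k + a) ≡ 2 * (a * (k + a)) + k * k
  squares = solve-∀

-- Both classes of the cut colouring have exactly `a * b` edges, half of all, so they exceed every
-- admissible threshold.
not-balanceable : ∀ {m M} → tri (suc m) ≡ 2 + 4 * M → ¬ Balanceable (T (suc m))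
not-balanceable {m} {M} tri≡ (n₀ , balanceable) =
  no-balanced-copy {M = M} a tri≡ (has-copy (cutColouring a) (subst (threshold <_) (sym red≡) threshold<) (subst (threshold <_) (sym blue≡) threshold<))
  where
  a = tri n₀
  b = tri (suc n₀)
  n = a + b
  n≥n₀ : n ≥ n₀
  n≥n₀ = ≤-trans (m≤m+n n₀ a) (m≤n+m b a)
  threshold = proj₁ (balanceable n n≥n₀)
  has-copy  = proj₂ (proj₂ (balanceable n n≥n₀))

  tri-n : tri n ≡ a * b + a * b
  tri-n = trans (tri-+ a b) (cong (_+ a * b) (square-halving n₀))

  threshold< : threshold < a * b
  threshold< = subst (threshold <_)
    (trans (cong ⌊_/2⌋ (trans (nC2≡tri n) tri-n)) (sym (n≡⌊n+n/2⌋ (a * b))))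
    (proj₁ (proj₂ (balanceable n n≥n₀)))

  red≡ : count {n} (cutColouring a) red ≡ a * b
  red≡ = trans (count-cut a (m≤m+n a b)) (cong (a *_) (m+n∸m≡n a b))

  blue≡ : count {n} (cutColouring a) blue ≡ a * b
  blue≡ = +-cancelˡ-≡ (a * b) _ _ (begin
    a * b + count α blue         ≡⟨ cong (_+ count α blue) red≡ ⟨
    count α red + count α blue   ≡⟨ length-++ (coloured α red (edges n)) ⟨
    length (coloured α red (edges n) ++ coloured α blue (edges n)) ≡⟨ ↭-length (colour-classes α (edges n)) ⟩
    length (edges n)             ≡⟨ length-edges n ⟩
    tri n                        ≡⟨ tri-n ⟩
    a * b + a * b                ∎)
    where
    open ≡-Reasoning
    α = cutColouring {n} a

-- Unavoidable patterns

pigeonhole : ∀ p q {x y} → p + q ≤ x + y → p ≤ x ⊎ q ≤ y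
pigeonhole p q {x} {y} le with p ≤? x
... | yes p≤x = inj₁ p≤x
... | no  p≰x = inj₂ (≮⇒≥ λ y<q → <-irrefl refl (<-≤-trans (+-mono-< (≰⇒> p≰x) y<q) le))

length-filter-¬ : ∀ {P : Pred A 0ℓ} (P? : Decidable P) xs →
                  length (filter P? xs) + length (filter (¬? ∘ P?) xs) ≡ length xs
length-filter-¬ P? []       = refl
length-filter-¬ P? (x ∷ xs) with does (P? x)
... | true  = cong suc (length-filter-¬ P? xs)
... | false = trans (+-suc _ _) (cong suc (length-filter-¬ P? xs))

allPairs-⊆ : ∀ {R : A → A → Set} {xs ys} → xs ⊆ ys → AllPairs R ys → AllPairs R xs
allPairs-⊆ []         []         = []
allPairs-⊆ (_ ∷ʳ τ)   (_ ∷ ps)   = allPairs-⊆ τ ps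
allPairs-⊆ (refl ∷ τ) (p ∷ ps)   = All-resp-⊆ τ p ∷ allPairs-⊆ τ ps

allPairs-lookup : ∀ {R : A → A → Set} → Symmetric R → ∀ {xs} → AllPairs R xs →
                  ∀ {i j} → i ≢ j → R (lookup xs i) (lookup xs j)
allPairs-lookup sym-R (p ∷ ps) {Fin.zero}  {Fin.zero}  i≢j = contradiction refl i≢j
allPairs-lookup sym-R (p ∷ ps) {Fin.zero}  {Fin.suc j} i≢j = All.lookup p (∈-lookup j)
allPairs-lookup sym-R (p ∷ ps) {Fin.suc i} {Fin.zero}  i≢j = sym-R (All.lookup p (∈-lookup i))
allPairs-lookup sym-R (p ∷ ps) {Fin.suc i} {Fin.suc j} i≢j = allPairs-lookup sym-R ps (i≢j ∘ cong Fin.suc)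

-- Each `x` splits what is left of `ys` by `R x`; keeping the larger part costs a factor of two per
-- element of `xs`.
homogeneous : ∀ {R : A → B → Set} → Binary.Decidable R → ∀ M xs ys → 2 ^ length xs * M ≤ length ys →
              ∃[ zs ] zs ⊆ ys × M ≤ length zs × (∀ {x y z} → x ∈ xs → y ∈ zs → z ∈ zs → R x y → R x z)
homogeneous R? M []       ys M≤ = ys , ⊆-refl , subst (_≤ length ys) (+-identityʳ M) M≤ , λ ()
homogeneous {R = R} R? M (x ∷ xs) ys M≤
  with pigeonhole (2 ^ length xs * M) (2 ^ length xs * M)
         (≤-trans (≤-reflexive (double (2 ^ length xs) M)) (≤-trans M≤ (≤-reflexive (sym (length-filter-¬ (R? x) ys)))))
  where
  double : ∀ k M → k * M + k * M ≡ (k + (k + 0)) * M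
  double = solve-∀
... | inj₁ M≤′ with homogeneous R? M xs (filter (R? x) ys) M≤′
...   | zs , zs⊆ , le , hom = zs , ⊆-trans zs⊆ (filter-⊆ (R? x) ys) , le ,
        λ { (here refl) _ z∈ _ → proj₂ (∈-filter⁻ (R? x) {xs = ys} (Sublist.lookup zs⊆ z∈))
          ; (there x∈) → hom x∈ }
homogeneous {R = R} R? M (x ∷ xs) ys M≤ | inj₂ M≤′ with homogeneous R? M xs (filter (¬? ∘ R? x) ys) M≤′
...   | zs , zs⊆ , le , hom = zs , ⊆-trans zs⊆ (filter-⊆ (¬? ∘ R? x) ys) , le ,
        λ { (here refl) y∈ _ r → contradiction r (proj₂ (∈-filter⁻ (¬? ∘ R? x) {xs = ys} (Sublist.lookup zs⊆ y∈)))
          ; (there x∈) → hom x∈ }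

opposite-involutive : ∀ c → opposite (opposite c) ≡ c
opposite-involutive red  = refl
opposite-involutive blue = refl

-- An upper bound for the Ramsey number; the successor accounts for the vertex whose neighbourhoods
-- are split.
ramseyNumber : ℕ → ℕ → ℕ
ramseyNumber zero    b       = 0
ramseyNumber (suc a) zero    = 0
ramseyNumber (suc a) (suc b) = suc (ramseyNumber a (suc b) + ramseyNumber (suc a) b)

-- Of two opposite cliques, one must supply `t + t` vertices. The other must keep `2 ^ (t + t) * t`
-- after losing the one vertex they may share, so that `homogeneous` leaves `t`. The sum covers both
-- demands.
mixedSize : ℕ → ℕ
mixedSize t = suc (2 ^ (t + t) * t) + (t + t)

-- At least 16N vertices have degree n/8 or more, and by averaging n/16 vertices have at least N
-- neighbours among 16N such vertices.
bicliqueSize : ℕ → ℕ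
bicliqueSize N = 8 * (16 * N) + 4 + 16 * (2 ^ (16 * N) * N)

patternSize : ℕ → ℕ
patternSize t = ramseyNumber (mixedSize t) (mixedSize t) + bicliqueSize (t + ramseyNumber t (mixedSize t))

∑-⟦⟧≤length : ∀ (b : A → Bool) xs → ∑ (⟦_⟧ ∘ b) xs ≤ length xs
∑-⟦⟧≤length b xs = ≤-trans (∑-mono-∈ xs (λ {x} _ → ⟦⟧≤1 (b x))) (≤-reflexive (∑-const-1 xs))
  where
  ⟦⟧≤1 : ∀ b → ⟦ b ⟧ ≤ 1
  ⟦⟧≤1 true  = s≤s z≤n
  ⟦⟧≤1 false = z≤n

module _ {n} (α : Colouring n) where

  adj-sym : ∀ {c} → Symmetric (Adj α c)
  adj-sym (e , j , eq) = e , joins-sym {e = e} j , eq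

  adj-irrefl : ∀ {c x} → ¬ Adj α c x x
  adj-irrefl (e , j , _) = joins-irrefl {e = e} j refl

  adj-disjoint : ∀ {c x y} → Adj α c x y → ¬ Adj α (opposite c) x y
  adj-disjoint {c} (e , j , eq) (e′ , j′ , eq′) rewrite joins-unique {e = e} {e′} j j′ =
    opposite-≢ c (trans (sym eq′) eq)

  adj-total : ∀ c {x y} → x ≢ y → Adj α c x y ⊎ Adj α (opposite c) x y
  adj-total c x≢y with edge-between x≢y
  ... | e , j with α e in eq | c
  ...   | red  | red  = inj₁ (e , j , eq)
  ...   | red  | blue = inj₂ (e , j , eq)
  ...   | blue | red  = inj₂ (e , j , eq)
  ...   | blue | blue = inj₁ (e , j , eq)

  adj? : ∀ c → Binary.Decidable (Adj α c)
  adj? c x y with x Finₚ.≟ y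
  ... | yes refl = no adj-irrefl
  ... | no  x≢y with adj-total c x≢y
  ...   | inj₁ a = yes a
  ...   | inj₂ a = no λ a′ → adj-disjoint a′ a

  non-adj : ∀ {c x y} → x ≢ y → ¬ Adj α c x y → Adj α (opposite c) x y
  non-adj {c} x≢y ¬a = [ flip contradiction ¬a , id ]′ (adj-total c x≢y)

  Clique : Colour → List (Fin n) → Set
  Clique c = AllPairs (Adj α c)

  SubClique : Colour → ℕ → List (Fin n) → Set
  SubClique c k xs = ∃[ ys ] ys ⊆ xs × length ys ≡ k × Clique c ys

  subClique-⊆ : ∀ {c k xs ys} → xs ⊆ ys → SubClique c k xs → SubClique c k ys
  subClique-⊆ τ (zs , zs⊆ , clique) = zs , ⊆-trans zs⊆ τ , clique

  subClique-∷ : ∀ {c k x ys xs} → ys ⊆ xs → (∀ {y} → y ∈ ys → Adj α c x y) →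
                SubClique c k ys → SubClique c (suc k) (x ∷ xs)
  subClique-∷ τ adjacent (zs , zs⊆ , len , clique) =
    _ ∷ zs , refl ∷ ⊆-trans zs⊆ τ , cong suc len , All.tabulate (adjacent ∘ Sublist.lookup zs⊆) ∷ clique

  ramsey : ∀ c a b xs → Unique xs → ramseyNumber a b ≤ length xs →
           SubClique c a xs ⊎ SubClique (opposite c) b xs
  ramsey c zero    b       xs xs! le = inj₁ ([] , Sublist.minimum xs , refl , [])
  ramsey c (suc a) zero    xs xs! le = inj₂ ([] , Sublist.minimum xs , refl , [])
  ramsey c (suc a) (suc b) (x ∷ xs) (x∉ ∷ xs!) (s≤s le)
    with pigeonhole (ramseyNumber a (suc b)) _ (≤-trans le (≤-reflexive (sym (length-filter-¬ (adj? c x) xs))))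
  ... | inj₁ le′ = Sum.map
          (subClique-∷ ys⊆ (proj₂ ∘ ∈-filter⁻ (adj? c x) {xs = xs}))
          (subClique-⊆ (x ∷ʳ ys⊆))
          (ramsey c a (suc b) _ (allPairs-⊆ ys⊆ xs!) le′)
    where ys⊆ = filter-⊆ (adj? c x) xs
  ... | inj₂ le′ = Sum.map
          (subClique-⊆ (x ∷ʳ ys⊆))
          (subClique-∷ ys⊆ λ y∈ → let y∈xs , ¬a = ∈-filter⁻ (¬? ∘ adj? c x) y∈ in
                                  non-adj (All.lookup x∉ y∈xs) ¬a)
          (ramsey c (suc a) b _ (allPairs-⊆ ys⊆ xs!) le′)
    where ys⊆ = filter-⊆ (¬? ∘ adj? c x) xs

  -- For `_∧_`, a clique of colour `c` with all else in the other colour; for `_xor_`, two cliques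
  -- of the other colour joined by `c`. Only distinct indices are compared, even across the sides,
  -- because every grid vertex will receive its own index.
  record Pattern (t : ℕ) (β : Bool → Bool → Bool) (c : Colour) : Set where
    field
      place  : Bool → Fin t → Fin n
      colour : ∀ s s′ {x y} → x ≢ y →
               Adj α (if β s s′ then c else opposite c) (place s x) (place s′ y)

  module _ {t} {a b d : Colour} {xs ys : List (Fin n)}
           (xs-clique : Clique a xs) (ys-clique : Clique b ys)
           (t≤xs : t ≤ length xs) (t≤ys : t ≤ length ys)
           (across : ∀ {x y} → x ∈ xs → y ∈ ys → Adj α d x y) where

    pattern-of-cliques : ∀ β c →
      a ≡ (if β true true then c else opposite c) → b ≡ (if β false false then c else opposite c) →
      d ≡ (if β true false then c else opposite c) → d ≡ (if β false true then c else opposite c) →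
      Pattern t β c
    pattern-of-cliques β c tt ff tf ft = record { place = place ; colour = colour }
      where
      place : Bool → Fin t → Fin n
      place true  i = lookup xs (Fin.inject≤ i t≤xs)
      place false i = lookup ys (Fin.inject≤ i t≤ys)
      colour : ∀ s s′ {x y} → x ≢ y → Adj α (if β s s′ then c else opposite c) (place s x) (place s′ y)
      colour true  true  x≢y rewrite sym tt = allPairs-lookup adj-sym xs-clique (x≢y ∘ Finₚ.inject≤-injective t≤xs t≤xs _ _)
      colour false false x≢y rewrite sym ff = allPairs-lookup adj-sym ys-clique (x≢y ∘ Finₚ.inject≤-injective t≤ys t≤ys _ _)
      colour true  false {x} {y} _ rewrite sym tf = across (∈-lookup (Fin.inject≤ x t≤xs)) (∈-lookup (Fin.inject≤ y t≤ys))
      colour false true {x} {y} _ rewrite sym ft = adj-sym (across (∈-lookup (Fin.inject≤ y t≤xs)) (∈-lookup (Fin.inject≤ x t≤ys)))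

  open DecMembership (Finₚ._≟_ {n}) using (_∈?_)

  clique-adj : ∀ {c xs} → Clique c xs → ∀ {x y} → x ∈ xs → y ∈ xs → x ≢ y → Adj α c x y
  clique-adj (p ∷ ps) (here refl) (here refl) x≢y = contradiction refl x≢y
  clique-adj (p ∷ ps) (here refl) (there y∈)  x≢y = All.lookup p y∈
  clique-adj (p ∷ ps) (there x∈)  (here refl) x≢y = adj-sym (All.lookup p x∈)
  clique-adj (p ∷ ps) (there x∈)  (there y∈)  x≢y = clique-adj ps x∈ y∈ x≢y

  -- Cliques of opposite colours share at most one vertex.
  length-∖ : ∀ {c xs ys} → Clique c xs → Clique (opposite c) ys →
             length ys ≤ 1 + length (filter (¬? ∘ (_∈? xs)) ys)
  length-∖ {c} {xs} {ys} xs-clique ys-clique =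
    ≤-trans (≤-reflexive (sym (length-filter-¬ (_∈? xs) ys))) (+-monoˡ-≤ _ at-most-one)
    where
    at-most-one : length (filter (_∈? xs) ys) ≤ 1
    at-most-one with filter (_∈? xs) ys | AllPairsₚ.filter⁺ (_∈? xs) ys-clique | (λ {z} → ∈-filter⁻ (_∈? xs) {v = z} {ys})
    ... | []         | _ | _  = z≤n
    ... | _ ∷ []     | _ | _  = s≤s z≤n
    ... | y ∷ z ∷ _  | (p ∷ _) ∷ _ | common =
      contradiction p (adj-disjoint (clique-adj xs-clique (proj₂ (common (here refl))) (proj₂ (common (there (here refl))))
        λ { refl → adj-irrefl p }))

  -- Each `x` sees all of the homogeneous part `z ∷ zs` in one colour, which `z` reveals. Of the
  -- `2t` vertices of `xs`, at least `t` agree: if joined by `c`, the part in `ys` is the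
  -- distinguished clique, of colour `opposite c`; otherwise those in `xs` are, with colour `c`.
  disjoint-cliques : ∀ {t c} .{{_ : NonZero t}} xs ys →
                     length xs ≡ t + t → 2 ^ (t + t) * t ≤ length ys →
                     (∀ {x y} → x ∈ xs → y ∈ ys → x ≢ y) →
                     Clique c xs → Clique (opposite c) ys → ∃[ d ] Pattern t _∧_ d
  disjoint-cliques {t} {c} xs ys len-xs len-ys distinct xs-clique ys-clique
    with homogeneous (adj? c) t xs ys (subst (λ l → 2 ^ l * t ≤ length ys) (sym len-xs) len-ys)
  ... | []     , _   , t≤0  , _   = contradiction (n≤0⇒n≡0 t≤0) (≢-nonZero⁻¹ t)
  ... | z ∷ zs , zs⊆ , t≤zs , hom =
    [ (λ t≤near → opposite c ,
        pattern-of-cliques zs-clique near-clique t≤zs t≤near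
          (λ z∈ x∈ → let x∈xs , a = ∈-filter⁻ (flip (adj? c) z) {xs = xs} x∈ in
                     adj-sym (hom x∈xs (here refl) z∈ a))
          _∧_ (opposite c) refl (sym (opposite-involutive c)) (sym (opposite-involutive c)) (sym (opposite-involutive c)))
    , (λ t≤far → c ,
        pattern-of-cliques far-clique zs-clique t≤far t≤zs
          (λ x∈ z∈ → let x∈xs , ¬a = ∈-filter⁻ (¬? ∘ flip (adj? c) z) {xs = xs} x∈ in
                     non-adj (distinct x∈xs (Sublist.lookup zs⊆ z∈)) λ a → ¬a (hom x∈xs z∈ (here refl) a))
          _∧_ c refl refl refl refl)
    ]′ (pigeonhole t t (≤-reflexive (sym (trans (length-filter-¬ (flip (adj? c) z) xs) len-xs))))
    where
    zs-clique = allPairs-⊆ zs⊆ ys-clique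
    near-clique = AllPairsₚ.filter⁺ (flip (adj? c) z) xs-clique
    far-clique  = AllPairsₚ.filter⁺ (¬? ∘ flip (adj? c) z) xs-clique

  opposite-cliques : ∀ {t c xs ys} .{{_ : NonZero t}} →
                     length xs ≡ mixedSize t → length ys ≡ mixedSize t →
                     Clique c xs → Clique (opposite c) ys → ∃[ d ] Pattern t _∧_ d
  opposite-cliques {t} {c} {xs} {ys} len-xs len-ys xs-clique ys-clique =
    disjoint-cliques (take (t + t) xs) (filter (¬? ∘ (_∈? xs)) ys)
      (trans (length-take (t + t) xs) (m≤n⇒m⊓n≡m (≤-trans (m≤n+m (t + t) (suc (2 ^ (t + t) * t))) (≤-reflexive (sym len-xs)))))
      (s≤s⁻¹ (≤-trans (≤-trans (m≤m+n _ (t + t)) (≤-reflexive (sym len-ys))) (length-∖ xs-clique ys-clique)))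
      (λ { x∈ y∈ refl → proj₂ (∈-filter⁻ (¬? ∘ (_∈? xs)) {xs = ys} y∈) (Sublist.lookup (take-⊆ (t + t) xs) x∈) })
      (AllPairsₚ.take⁺ (t + t) xs-clique)
      (AllPairsₚ.filter⁺ (¬? ∘ (_∈? xs)) ys-clique)

  -- Large bicliques in a dense colour class

  degree : Colour → Fin n → ℕ
  degree c x = ∑ (λ y → ⟦ does (adj? c x y) ⟧) (allFin n)

  degree≤n : ∀ c x → degree c x ≤ n
  degree≤n c x = ≤-trans (∑-⟦⟧≤length (does ∘ adj? c x) (allFin n)) (≤-reflexive (length-tabulate id))

  -- Each edge is charged to its smaller endpoint only; the constants absorb the factor of two lost.
  count≤∑degree : ∀ c → count α c ≤ ∑ (degree c) (allFin n)
  count≤∑degree c = begin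
    count α c
      ≡⟨ length-filter _ (edges n) ⟩
    ∑ (λ e → ⟦ does (α e ≟ᶜ c) ⟧) (edges n)
      ≡⟨ ∑-edges n _ ⟩
    ∑ (λ x → ∑ (λ y → selected (uncurry Fin._<?_) (λ e → ⟦ does (α e ≟ᶜ c) ⟧) (x , y)) (allFin n)) (allFin n)
      ≤⟨ ∑-mono-∈ (allFin n) (λ {x} _ → ∑-mono-∈ (allFin n) λ {y} _ → bound x y) ⟩
    ∑ (degree c) (allFin n) ∎
    where
    open ≤-Reasoning
    bound : ∀ x y → selected (uncurry Fin._<?_) (λ e → ⟦ does (α e ≟ᶜ c) ⟧) (x , y) ≤ ⟦ does (adj? c x y) ⟧
    bound x y with x Fin.<? y
    ... | no _ = z≤n
    ... | yes x<y with α ((x , y) , x<y) ≟ᶜ c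
    ...   | no _   = z≤n
    ...   | yes eq rewrite dec-true (adj? c x y) (((x , y) , x<y) , inj₁ (refl , refl) , eq) = ≤-refl

  -- Averaging: terms below `p` contribute at most `p` each, the others at most `m`. The factor `k`
  -- stands in for the fractional threshold `p / k`.
  ∑-threshold : ∀ {A : Set} (f : A → ℕ) p k m xs → (∀ {x} → x ∈ xs → k * f x ≤ m) →
                k * ∑ f xs ≤ length xs * p + length (filter (λ x → p ≤? k * f x) xs) * m
  ∑-threshold f p k m []       bound = ≤-reflexive (*-zeroʳ k)
  ∑-threshold f p k m (x ∷ xs) bound with p ≤? k * f x | ∑-threshold f p k m xs (bound ∘ there)
  ... | yes p≤ | le rewrite dec-true (p ≤? k * f x) p≤ = begin
    k * (f x + ∑ f xs)                        ≡⟨ *-distribˡ-+ k (f x) _ ⟩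
    k * f x + k * ∑ f xs                      ≤⟨ +-mono-≤ (bound (here refl)) le ⟩
    m + (length xs * p + _)                   ≤⟨ m≤n+m _ p ⟩
    p + (m + (length xs * p + _))             ≡⟨ rearrange p m (length xs * p) _ ⟩
    (p + length xs * p) + (m + _)             ∎
    where
    open ≤-Reasoning
    rearrange : ∀ p m a b → p + (m + (a + b)) ≡ (p + a) + (m + b)
    rearrange = solve-∀
  ... | no p≰ | le rewrite dec-false (p ≤? k * f x) p≰ = begin
    k * (f x + ∑ f xs)                        ≡⟨ *-distribˡ-+ k (f x) _ ⟩
    k * f x + k * ∑ f xs                      ≤⟨ +-mono-≤ (<⇒≤ (≰⇒> p≰)) le ⟩
    p + (length xs * p + _)                   ≡⟨ +-assoc p _ _ ⟨
    p + length xs * p + _                     ∎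
    where open ≤-Reasoning

  -- Eight times the class size is `2n²` up to linear terms. Vertices of degree below `n / 8`
  -- account for at most `n²` of it and the `G` others for at most `8n` each, leaving `n ≤ 8G + 3`.
  -- The 3 collects `2n` from the linear term of `tri`, twice, and `4 ≤ n` for rounding the half.
  many-high-degrees : ∀ {c L} → ⌊ tri n /2⌋ ≤ count α c → 8 * L + 4 ≤ n →
                      L ≤ length (filter (λ x → n ≤? 8 * degree c x) (allFin n))
  many-high-degrees {c} {L} half≤ n-large = ≮⇒≥ λ G<L → <-irrefl refl (begin-strict
    n                    ≤⟨ *-cancelʳ-≤ n (8 * G + 3) n {{>-nonZero (≤-trans (s≤s z≤n) 4≤n)}} quadratic ⟩
    8 * G + 3            <⟨ +-mono-≤-< (*-monoʳ-≤ 8 (<⇒≤ G<L)) (n<1+n 3) ⟩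
    8 * L + 4            ≤⟨ n-large ⟩
    n                    ∎)
    where
    open ≤-Reasoning
    G = length (filter (λ x → n ≤? 8 * degree c x) (allFin n))
    F = ⌊ tri n /2⌋
    4≤n = ≤-trans (m≤n+m 4 (8 * L)) n-large

    tri≤ : ∀ m → m ≤ suc (2 * ⌊ m /2⌋)
    tri≤ zero          = z≤n
    tri≤ (suc zero)    = s≤s z≤n
    tri≤ (suc (suc m)) = s≤s (s≤s (≤-trans (tri≤ m) (≤-reflexive (sym (+-suc ⌊ m /2⌋ _)))))

    8F≤ : 8 * F ≤ n * n + G * (8 * n)
    8F≤ = begin
      8 * F                          ≤⟨ *-monoʳ-≤ 8 (≤-trans half≤ (count≤∑degree c)) ⟩
      8 * ∑ (degree c) (allFin n)    ≤⟨ ∑-threshold (degree c) n 8 (8 * n) (allFin n) (λ {x} _ → *-monoʳ-≤ 8 (degree≤n c x)) ⟩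
      length (allFin n) * n + G * (8 * n) ≡⟨ cong (λ l → l * n + G * (8 * n)) (length-tabulate {n = n} id) ⟩
      n * n + G * (8 * n)            ∎

    quadratic : n * n ≤ (8 * G + 3) * n
    quadratic = +-cancelˡ-≤ (n * n) _ _ (begin
      n * n + n * n                       ≡⟨ cong₂ _+_ (2*tri+n≡n² n) (2*tri+n≡n² n) ⟨
      (2 * tri n + n) + (2 * tri n + n)   ≤⟨ +-mono-≤ (+-monoˡ-≤ n (*-monoʳ-≤ 2 (tri≤ (tri n)))) (+-monoˡ-≤ n (*-monoʳ-≤ 2 (tri≤ (tri n)))) ⟩
      (2 * suc (2 * F) + n) + (2 * suc (2 * F) + n) ≡⟨ expand F n ⟩
      8 * F + (4 + (n + n))               ≤⟨ +-mono-≤ 8F≤ (+-monoˡ-≤ (n + n) 4≤n) ⟩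
      n * n + G * (8 * n) + (n + (n + n)) ≡⟨ collect n G ⟩
      n * n + (8 * G + 3) * n             ∎)
      where
      expand : ∀ F n → (2 * suc (2 * F) + n) + (2 * suc (2 * F) + n) ≡ 8 * F + (4 + (n + n))
      expand = solve-∀
      collect : ∀ n G → n * n + G * (8 * n) + (n + (n + n)) ≡ n * n + (8 * G + 3) * n
      collect = solve-∀

  -- Count the pairs of a vertex of `xs` and a neighbour: there are at least `2Nn`. Vertices with
  -- fewer than `N` neighbours in `xs` account for at most `Nn`, and each of the others for at most
  -- `16N`.
  many-common-neighbours : ∀ {c} N .{{_ : NonZero N}} xs → length xs ≡ 16 * N → (∀ {x} → x ∈ xs → n ≤ 8 * degree c x) →
                           n ≤ 16 * length (filter (λ y → N ≤? 1 * ∑ (λ x → ⟦ does (adj? c x y) ⟧) xs) (allFin n))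
  many-common-neighbours {c} N xs len-xs high = +-cancelˡ-≤ n _ _ (*-cancelˡ-≤ (8 * N) {{m*n≢0 8 N}} (begin
    8 * N * (n + n)                       ≡⟨ 16Nn N n ⟩
    16 * N * n                            ≡⟨ cong (_* n) len-xs ⟨
    length xs * n                         ≡⟨ ∑-const n xs ⟨
    ∑ (const n) xs                        ≤⟨ ∑-mono-∈ xs high ⟩
    ∑ (λ x → 8 * degree c x) xs           ≡⟨ ∑-*ˡ 8 (degree c) xs ⟩
    8 * ∑ (degree c) xs                   ≡⟨ cong (8 *_) (∑-swap (λ x y → ⟦ does (adj? c x y) ⟧) xs (allFin n)) ⟩
    8 * ∑ e (allFin n)                    ≡⟨ cong (8 *_) (*-identityˡ (∑ e (allFin n))) ⟨
    8 * (1 * ∑ e (allFin n))              ≤⟨ *-monoʳ-≤ 8 (∑-threshold e N 1 (16 * N) (allFin n) λ {y} _ →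
                                               ≤-trans (≤-reflexive (*-identityˡ (e y)))
                                               (≤-trans (∑-⟦⟧≤length (λ x → does (adj? c x y)) xs) (≤-reflexive len-xs))) ⟩
    8 * (length (allFin n) * N + Y * (16 * N)) ≡⟨ cong (λ l → 8 * (l * N + Y * (16 * N))) (length-tabulate {n = n} id) ⟩
    8 * (n * N + Y * (16 * N))            ≡⟨ collect n N Y ⟩
    8 * N * (n + 16 * Y)                  ∎))
    where
    open ≤-Reasoning
    e : Fin n → ℕ
    e y = ∑ (λ x → ⟦ does (adj? c x y) ⟧) xs
    Y = length (filter (λ y → N ≤? 1 * e y) (allFin n))
    16Nn : ∀ N n → 8 * N * (n + n) ≡ 16 * N * n
    16Nn = solve-∀
    collect : ∀ n N Y → 8 * (n * N + Y * (16 * N)) ≡ 8 * N * (n + 16 * Y)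
    collect = solve-∀

  -- After `homogeneous`, all remaining vertices of `ys` have the same neighbours in `xs`; those of
  -- a single one, at least `N`, form the first side.
  biclique : ∀ {c} N .{{_ : NonZero N}} → ⌊ tri n /2⌋ ≤ count α c → bicliqueSize N ≤ n →
             ∃[ xs ] ∃[ ys ] Unique xs × Unique ys × N ≤ length xs × N ≤ length ys ×
             (∀ {x y} → x ∈ xs → y ∈ ys → Adj α c x y)
  biclique {c} N half≤ n-large = finish (homogeneous (adj? c) N xs ys ys-large)
    where
    high? : Decidable (λ x → n ≤ 8 * degree c x)
    high? x = n ≤? 8 * degree c x
    xs : List (Fin n)
    xs = take (16 * N) (filter high? (allFin n))
    common : Fin n → ℕ
    common y = ∑ (λ x → ⟦ does (adj? c x y) ⟧) xs
    ys : List (Fin n)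
    ys = filter (λ y → N ≤? 1 * common y) (allFin n)
    len-xs : length xs ≡ 16 * N
    len-xs = trans (length-take (16 * N) (filter high? (allFin n)))
      (m≤n⇒m⊓n≡m (many-high-degrees half≤ (≤-trans (m≤m+n (8 * (16 * N) + 4) _) n-large)))
    xs-high : ∀ {x} → x ∈ xs → n ≤ 8 * degree c x
    xs-high x∈ = proj₂ (∈-filter⁻ high? {xs = allFin n} (Sublist.lookup (take-⊆ (16 * N) (filter high? (allFin n))) x∈))
    ys-large : 2 ^ length xs * N ≤ length ys
    ys-large = *-cancelˡ-≤ 16 (begin
      16 * (2 ^ length xs * N)    ≡⟨ cong (λ l → 16 * (2 ^ l * N)) len-xs ⟩
      16 * (2 ^ (16 * N) * N)     ≤⟨ m≤n+m _ (8 * (16 * N) + 4) ⟩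
      bicliqueSize N              ≤⟨ n-large ⟩
      n                           ≤⟨ many-common-neighbours N xs len-xs xs-high ⟩
      16 * length ys              ∎)
      where open ≤-Reasoning
    finish : (∃[ zs ] zs ⊆ ys × N ≤ length zs × (∀ {x y z} → x ∈ xs → y ∈ zs → z ∈ zs → Adj α c x y → Adj α c x z)) →
             ∃[ xs ] ∃[ ys ] Unique xs × Unique ys × N ≤ length xs × N ≤ length ys ×
             (∀ {x y} → x ∈ xs → y ∈ ys → Adj α c x y)
    finish ([]     , _   , N≤0  , _)   = contradiction (n≤0⇒n≡0 N≤0) (≢-nonZero⁻¹ N)
    finish (z ∷ zs , zs⊆ , N≤zs , hom) =
        filter adj-z? xs , z ∷ zs
      , Uniqueₚ.filter⁺ adj-z? (Uniqueₚ.take⁺ (16 * N) (Uniqueₚ.filter⁺ high? (Uniqueₚ.allFin⁺ n)))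
      , allPairs-⊆ zs⊆ (Uniqueₚ.filter⁺ (λ y → N ≤? 1 * common y) (Uniqueₚ.allFin⁺ n))
      , N≤xs , N≤zs
      , λ x∈ y∈ → let x∈xs , a = ∈-filter⁻ adj-z? {xs = xs} x∈ in hom x∈xs (here refl) y∈ a
      where
      adj-z? : Decidable (λ x → Adj α c x z)
      adj-z? x = adj? c x z
      N≤xs : N ≤ length (filter adj-z? xs)
      N≤xs = begin
        N                         ≤⟨ proj₂ (∈-filter⁻ (λ y → N ≤? 1 * common y) {xs = allFin n} (Sublist.lookup zs⊆ (here refl))) ⟩
        1 * common z              ≡⟨ *-identityˡ (common z) ⟩
        common z                  ≡⟨ length-filter adj-z? xs ⟨
        length (filter adj-z? xs) ∎
        where open ≤-Reasoning

  patterns : ∀ t .{{_ : NonZero t}} → (∀ c → ⌊ tri n /2⌋ ≤ count α c) → patternSize t ≤ n →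
             (∃[ c ] Pattern t _∧_ c) ⊎ (∃[ c ] Pattern t _xor_ c)
  patterns t half≤ n-large =
    [ from-clique red , from-clique blue ]′
      (ramsey red S S (allFin n) (Uniqueₚ.allFin⁺ n)
        (≤-trans (m+n≤o⇒m≤o (ramseyNumber S S) n-large) (≤-reflexive (sym (length-tabulate id)))))
    where
    S = mixedSize t
    N = t + ramseyNumber t S
    instance
      N-nonZero : NonZero N
      N-nonZero = >-nonZero (≤-trans (>-nonZero⁻¹ t) (m≤m+n t (ramseyNumber t S)))

    from-clique : ∀ c → SubClique c S (allFin n) → (∃[ c ] Pattern t _∧_ c) ⊎ (∃[ c ] Pattern t _xor_ c)
    from-clique c (_ , _ , len-as , as-clique) =
      let xs , ys , xs! , ys! , N≤xs , N≤ys , across =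
            biclique {opposite c} N (half≤ (opposite c)) (m+n≤o⇒n≤o (ramseyNumber S S) n-large)
      in combine across (ramsey c t S xs xs! (m+n≤o⇒n≤o t N≤xs)) (ramsey c t S ys ys! (m+n≤o⇒n≤o t N≤ys))
      where
      combine : ∀ {xs ys} → (∀ {x y} → x ∈ xs → y ∈ ys → Adj α (opposite c) x y) →
                SubClique c t xs ⊎ SubClique (opposite c) S xs →
                SubClique c t ys ⊎ SubClique (opposite c) S ys →
                (∃[ c ] Pattern t _∧_ c) ⊎ (∃[ c ] Pattern t _xor_ c)
      combine _ (inj₂ (_ , _ , len-bs , bs-clique)) _ = inj₁ (opposite-cliques len-as len-bs as-clique bs-clique)
      combine _ (inj₁ _) (inj₂ (_ , _ , len-bs , bs-clique)) = inj₁ (opposite-cliques len-as len-bs as-clique bs-clique)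
      combine across (inj₁ (_ , ps⊆ , len-ps , ps-clique)) (inj₁ (_ , qs⊆ , len-qs , qs-clique)) =
        inj₂ (opposite c , pattern-of-cliques ps-clique qs-clique (≤-reflexive (sym len-ps)) (≤-reflexive (sym len-qs))
          (λ x∈ y∈ → across (Sublist.lookup ps⊆ x∈) (Sublist.lookup qs⊆ y∈))
          _xor_ (opposite c) (sym (opposite-involutive c)) (sym (opposite-involutive c)) refl refl)

-- Balanceability

mod-injective : ∀ {i j k} .{{_ : NonZero k}} → i < k → j < k → i mod k ≡ j mod k → i ≡ j
mod-injective {i} {j} {k} i<k j<k eq =
  trans (sym (m<n⇒m%n≡m i<k)) (trans (Finₚ.fromℕ<-injective (i % k) (j % k) (m%n<n i k) (m%n<n j k) eq) (m<n⇒m%n≡m j<k))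

-- The two coordinates as digits in base `suc h`; `mod` makes this total and changes nothing on the
-- grid.
gridIndex : ∀ h → Point → Fin (suc h * suc h)
gridIndex h (i , j) = Fin.combine (i mod suc h) (j mod suc h)

gridIndex-injective : ∀ {h p q} → InGrid h p → InGrid h q → gridIndex h p ≡ gridIndex h q → p ≡ q
gridIndex-injective {h} {i , j} {k , l} (_ , i≤j , j≤h) (_ , k≤l , l≤h) eq =
  let eqˡ , eqʳ = Finₚ.combine-injective (i mod suc h) (j mod suc h) (k mod suc h) (l mod suc h) eq
  in cong₂ _,_ (mod-injective (s≤s (≤-trans i≤j j≤h)) (s≤s (≤-trans k≤l l≤h)) eqˡ) (mod-injective (s≤s j≤h) (s≤s l≤h) eqʳ)

pattern-copy : ∀ {n m β c} {α : Colouring n} → HalfSplit β m → Pattern α (suc (suc m) * suc (suc m)) β c →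
               BalancedCopy (T (suc m)) α
pattern-copy {m = m} {β} {c} {α} split@(s , _) pat =
  balanced-copy α {m} φ φ-injective β c split λ {p} {q} p∈ q∈ step →
    colour (s p) (s q) λ eq → step-irrefl (gridIndex-injective p∈ q∈ eq) step
  where
  open Pattern pat
  φ : Point → Fin _
  φ p = place (s p) (gridIndex (suc m) p)

  φ-injective : ∀ {p q} → InGrid (suc m) p → InGrid (suc m) q → φ p ≡ φ q → p ≡ q
  φ-injective {p} {q} p∈ q∈ eq with gridIndex (suc m) p Finₚ.≟ gridIndex (suc m) q
  ... | yes same = gridIndex-injective p∈ q∈ same
  -- Distinct indices are joined by an edge of one colour or the other, so their vertices differ.
  ... | no  diff = contradiction (subst (λ x → Adj α _ x (φ q)) eq (colour (s p) (s q) diff)) (adj-irrefl α)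

-- The threshold is the largest admissible one, which forces each class to hold at least half of the
-- edges, rounded down. The 3 makes that half positive, so that the threshold lies below it.
balanceable-from-patterns : ∀ G t .{{_ : NonZero t}} →
  (∀ {n c} {α : Colouring n} → Pattern α t _∧_ c → BalancedCopy G α) →
  (∀ {n c} {α : Colouring n} → Pattern α t _xor_ c → BalancedCopy G α) →
  Balanceable G
balanceable-from-patterns G t ∧-copy xor-copy = 3 + patternSize t , λ n n≥ →
  pred ⌊ n C 2 /2⌋ , ≤-reflexive (suc-pred ⌊ n C 2 /2⌋ {{half-positive (m+n≤o⇒m≤o 3 n≥)}}) , λ α red< blue< →
    let large : ∀ c → ⌊ tri n /2⌋ ≤ count α c
        large = λ where red  → half≤ n red<
                        blue → half≤ n blue<
    in [ (λ (_ , pat) → ∧-copy pat) , (λ (_ , pat) → xor-copy pat) ]′ (patterns α t large (m+n≤o⇒n≤o 3 n≥))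
  where
  half-positive : ∀ {n} → 3 ≤ n → NonZero ⌊ n C 2 /2⌋
  half-positive {n} 3≤n rewrite nC2≡tri n = >-nonZero (⌊n/2⌋-mono (≤-trans (n≤1+n 2) (tri-mono 3≤n)))

  half≤ : ∀ n {k} → pred ⌊ n C 2 /2⌋ < k → ⌊ tri n /2⌋ ≤ k
  half≤ n {k} le rewrite nC2≡tri n = ≤-trans suc-pred-≤ le
    where
    suc-pred-≤ : ⌊ tri n /2⌋ ≤ suc (pred ⌊ tri n /2⌋)
    suc-pred-≤ with ⌊ tri n /2⌋
    ... | zero  = z≤n
    ... | suc _ = ≤-refl

balanceable : ∀ m {M} → tri (suc m) ≡ 4 * M → m ≡ 0 ⊎ 7 ≤ m → Balanceable (T (suc m))
balanceable m {M} tri≡ range = balanceable-from-patterns (T (suc m)) (suc (suc m) * suc (suc m))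
  (pattern-copy (halfSplit-∧ m {M} tri≡ range)) (pattern-copy (halfSplit-xor m {M} tri≡))

theorem21 : ∀ (h : ℕ) → h ≥ 1 → h % 8 ∈ (0 ∷ 1 ∷ 4 ∷ 5 ∷ []) → Balanceable (T h) ⇔ h % 8 ∈ (0 ∷ 1 ∷ [])
theorem21 h@(suc m) _ h%8∈ = mk⇔ (necessary h%8∈) sufficient
  where
  tri≡ : ∀ {r} → h % 8 ≡ r → ∃[ M ] tri h ≡ tri r + 4 * M
  tri≡ refl = tri-% h

  -- The only positive `h` below 8 with residue 0 or 1 is `h = 1`.
  range : h % 8 ≡ 0 ⊎ h % 8 ≡ 1 → m ≡ 0 ⊎ 7 ≤ m
  range r with 7 ≤? m
  ... | yes 7≤m = inj₂ 7≤m
  ... | no  7≰m with m<n⇒m%n≡m {n = 8} (s≤s (≰⇒> 7≰m)) | r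
  ...   | small | inj₁ eq = contradiction (trans (sym small) eq) λ ()
  ...   | small | inj₂ eq = inj₁ (suc-injective (trans (sym small) eq))

  sufficient : h % 8 ∈ (0 ∷ 1 ∷ []) → Balanceable (T h)
  sufficient (here eq)         = let M , eq′ = tri≡ eq in balanceable m {M} eq′ (range (inj₁ eq))
  sufficient (there (here eq)) = let M , eq′ = tri≡ eq in balanceable m {M} eq′ (range (inj₂ eq))

  necessary : h % 8 ∈ (0 ∷ 1 ∷ 4 ∷ 5 ∷ []) → Balanceable (T h) → h % 8 ∈ (0 ∷ 1 ∷ [])
  necessary (here eq)                         _   = here eq
  necessary (there (here eq))                 _   = there (here eq)
  -- `tri 4 = 2 + 4 * 1` and `tri 5 = 2 + 4 * 2`, whence the witnesses `suc M` and `2 + M`.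
  necessary (there (there (here eq)))         bal =
    let M , tri≡6 = tri≡ eq in contradiction bal (not-balanceable {M = suc M} (trans tri≡6 (cong (2 +_) (sym (*-suc 4 M)))))
  necessary (there (there (there (here eq)))) bal =
    let M , tri≡10 = tri≡ eq in contradiction bal (not-balanceable {M = 2 + M}
      (trans tri≡10 (cong (2 +_) (sym (trans (*-suc 4 (suc M)) (cong (4 +_) (*-suc 4 M)))))))
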